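{- Let $a_2$ and $a_3$ be integers and let $\{u_n\}_{n\ge 0}$ be the third-order recurrence sequence defined by $$u_0=0,\quad u_1=-a_2,\quad u_2=-a_3,\qquad u_{n+3}+a_2u_{n+1}+a_3u_n=0\quad (n\ge 0).$$ Let $f=x^3+a_2x+a_3$, let $d=9a_3^2-4a_2^3$, and let $D=\mathrm{disc}(f)$. Let $p$ be a prime such that $$p\nmid 6Da_2a_3\bigl((20a_2^3a_3+27a_2^3+9a_2d)^2-d(31a_2^2+d)^2\bigr).$$ Then $$N_p(f)=\begin{cases}3 & \text{if } Du_{p-1}^2\equiv 0 \pmod p;\\ 0 & \text{if } Du_{p-1}^2\equiv a_2^4 \pmod p;\\ 1 & \text{otherwise.}\end{cases}$$
   Context: For a polynomial $f\in\mathbb{Z}[x]$ and a prime $p$, $N_p(f)$ denotes the number of integers $0\le a<p$ with $f(a)\equiv 0\pmod p$ (the number of distinct roots of $f$ modulo $p$). $\mathrm{disc}(f)$ is the discriminant of $f$. -}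

module Defs where

open import Data.Fin as Fin using (toℕ; splitAt)
open import Data.Integer using (ℤ; +-0-rawMonoid; +_; 0ℤ; 1ℤ; -1ℤ; _+_; _-_; _*_; _^_; _/_; NonZero)
open import Data.Integer.Divisibility.Signed using (_∣_; _∣?_)
open import Data.List using (length; filter; upTo)
open import Data.Nat as ℕ using (ℕ; zero; suc)
open import Data.Sum using ([_,_])
open import Data.Vec using (Vec; []; _∷_; head)
open import Data.Vec.Functional using (Vector; removeAt)
open import Algebra.Definitions.RawMonoid +-0-rawMonoid using (sum)

infix 4 _≡_[mod_]

_≡_[mod_] : ℤ → ℤ → ℕ → Set
a ≡ b [mod m ] = + m ∣ a - b

-- A polynomial in ℤ[x] of formal degree n is the vector of its n + 1
-- coefficients, leading coefficient first.
Poly : ℕ → Set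
Poly n = Vec ℤ (suc n)

eval : ∀ {k} → Vec ℤ k → ℤ → ℤ
eval []                 x = 0ℤ
eval (_∷_ {n = k} c cs) x = c * x ^ k + eval cs x

-- The constant coefficient (the last entry) is dropped.
derivative : ∀ {n} → Poly n → Vec ℤ n
derivative {zero}  _        = []
derivative {suc n} (c ∷ cs) = + suc n * c ∷ derivative cs

-- N p f counts integers 0 ≤ a < p, so roots are counted without multiplicity.
N : ∀ {n} → ℕ → Poly n → ℕ
N p f = length (filter (λ a → + p ∣? eval f (+ a)) (upTo p))

Matrix : ℕ → Set
Matrix n = Vector (Vector ℤ n) n

-- Laplace expansion along the first row.
det : ∀ {n} → Matrix n → ℤ
det {zero}  _ = 1ℤ
det {suc n} M = sum λ j →
  -1ℤ ^ toℕ j * (M Fin.zero j * det (λ i → removeAt (M (Fin.suc i)) j))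

-- shifted i f is the sequence 0, …, 0 (i times), followed by the
-- coefficients of f, followed by zeros.
shifted : ∀ {k} → ℕ → Vec ℤ k → ℕ → ℤ
shifted (suc i) cs       zero    = 0ℤ
shifted (suc i) cs       (suc j) = shifted i cs j
shifted zero    []       j       = 0ℤ
shifted zero    (c ∷ cs) zero    = c
shifted zero    (c ∷ cs) (suc j) = shifted zero cs j

-- n shifted rows of f above m shifted rows of g.
sylvester : ∀ {m n} → Poly m → Poly n → Matrix (n ℕ.+ m)
sylvester {n = n} f g i j =
  [ (λ r → shifted (toℕ r) f (toℕ j)) , (λ r → shifted (toℕ r) g (toℕ j)) ]
    (splitAt n i)

resultant : ∀ {m n} → Poly m → Poly n → ℤ
resultant f g = det (sylvester f g)

-- For f of degree n = m + 1 with leading coefficient c,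
-- disc f = (-1)^(n(n-1)/2) Res(f, f′) / c; the division is exact.
disc : ∀ {m} (f : Poly (suc m)) .{{_ : NonZero (head f)}} → ℤ
disc {m} f = -1ℤ ^ (suc m ℕ.* m ℕ./ 2) * resultant f (derivative f) / head f

{-# OPTIONS --safe #-}
-- Write x ^ p = A + B x + C x² in 𝔽ₚ[x]/(f); then u (p - 1) = A - a₂ C. As the Frobenius map is a ring
-- endomorphism, x ^ p + c and x + c have the same norm for every c, so x ^ p has characteristic
-- polynomial f. This forces A = - 2 a₂ t and C = - 3 t with a₂ t = u (p - 1), and leaves a quadratic and a
-- cubic equation for B and t.
-- If t = 0, they give x ^ p = x, so the product of all x - j with j in 𝔽ₚ vanishes, which needs two, hence
-- three, roots of f. A root r in 𝔽ₚ satisfies r = A + B r + C r², which is incompatible with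
-- D t² = a₂²; if D t² ≠ a₂² and t ≠ 0, then a₂ t / B is a root of f, and it is the only one because a second
-- root would produce a third and make the quadratic polynomial x ^ p - x vanish at all three.
module Submission where

open import Algebra.Bundles using (AbelianGroup; CommutativeRing)
import Algebra.Properties.CommutativeSemiring.Binomial as Binomial
import Algebra.Properties.Ring as RingProperties
import Algebra.Properties.Semiring.Exp as Exp
import Algebra.Properties.Semiring.Mult as Mult
import Algebra.Properties.Semiring.Sum as Sum
open import Data.Fin as Fin using (Fin; toℕ; fromℕ; inject₁; punchIn; splitAt)
import Data.Fin.Properties as Fin
open import Data.Nat using (ℕ; zero; suc; NonZero; _<_; _≤_; _!; _∸_; s≤s; z<s)
import Data.Nat as ℕ
import Data.Nat.Combinatorics as ℕ
open import Data.Nat.Combinatorics using (_C_)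
import Data.Nat.Coprimality as Coprimality
import Data.Nat.Divisibility as ℕ
import Data.Nat.DivMod as ℕ
open import Data.Nat.GCD using (module Bézout)
open import Data.Nat.Primality using (Prime; euclidsLemma; prime⇒nonZero; prime⇒nonTrivial)
import Data.Nat.Properties as ℕ
open import Data.Product using (∃-syntax; _×_; _,_; proj₁; proj₂)
open import Data.Sum as ⊎ using (_⊎_; inj₁; inj₂; [_,_])
open import Data.Vec using (Vec; []; _∷_; map)
open import Data.Vec.Functional as Vector using (Vector; removeAt)
open import Data.Vec.N-ary using (N-ary)
open import Function using (_∘_; _⇔_; mk⇔; id; module Equivalence)
open import Level using (0ℓ)
open import Relation.Binary using (IsEquivalence; Setoid)
open import Relation.Binary.PropositionalEquality as ≡ using (_≡_)
open import Relation.Nullary using (¬_; Dec; yes; no; contradiction)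

-- Commutative rings of prime characteristic

-- Over a splitting field Frobenius permutes the three roots of f, and x ^ p is the quadratic that
-- interpolates this permutation. The identity has t = 0. A three-cycle has t = a₂ / δ up to sign,
-- where δ is the product of the differences of the roots and δ² = D; hence D t² = a₂², which
-- becomes a₂⁴ after multiplication by a₂². A transposition fixing r has t (3 r² + a₂) = - r. These
-- are the three cases of the theorem. Polynomial identities in B and t replace the analysis of
-- permutations. The factorisation of x ^ p - x has to hold in a ring where a polynomial may have
-- more roots than its degree; Newton interpolation at 0, ..., p - 1 provides it, because the nodes
-- differ by integers that are invertible modulo p.

prime∤! : ∀ {p} → Prime p → ∀ {n} → n < p → ¬ (p ℕ.∣ n !)
prime∤! pp {zero} _ p∣1 = contradiction (ℕ.∣1⇒≡1 p∣1) (ℕ.nonTrivial⇒≢1 {{prime⇒nonTrivial pp}})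
prime∤! pp {suc n} n<p p∣ with euclidsLemma (suc n) (n !) pp p∣
... | inj₁ p∣n = ℕ.<⇒≱ n<p (ℕ.∣⇒≤ p∣n)
... | inj₂ p∣n! = prime∤! pp (ℕ.<⇒≤ n<p) p∣n!

C*k!*[n∸k]!≡n! : ∀ {n k} → k ≤ n → (n C k) ℕ.* (k ! ℕ.* (n ℕ.∸ k) !) ≡ n !
C*k!*[n∸k]!≡n! {n} {k} k≤n =
  ≡.trans (≡.cong (ℕ._* (k ! ℕ.* (n ℕ.∸ k) !)) (ℕ.nCk≡n!/k![n-k]! k≤n))
          (ℕ.m/n*n≡m (ℕ.k![n∸k]!∣n! k≤n))
  where instance _ = k ℕ.!* (n ℕ.∸ k) !≢0

-- The product of `p C k` with two factorials is `p !`, and `p` divides neither factorial, as both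
-- `k` and `p ∸ k` are below `p`.
prime∣C : ∀ {p} → Prime p → ∀ {k} → 0 < k → k < p → p ℕ.∣ p C k
prime∣C {suc n} pp {k} 0<k k<p
  with euclidsLemma (suc n C k) _ pp
         (≡.subst (suc n ℕ.∣_) (≡.sym (C*k!*[n∸k]!≡n! (ℕ.<⇒≤ k<p))) (ℕ.m∣m*n (n !)))
... | inj₁ p∣C = p∣C
... | inj₂ p∣d with euclidsLemma (k !) _ pp p∣d
...   | inj₁ p∣k! = contradiction p∣k! (prime∤! pp k<p)
...   | inj₂ p∣r! = contradiction p∣r! (prime∤! pp (ℕ.∸-monoʳ-< 0<k (ℕ.<⇒≤ k<p)))

-- No cancellation law is assumed of `S`: the results are applied to 𝔽ₚ and to 𝔽ₚ[x]/(f).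
module Characteristic {c ℓ} (S : CommutativeRing c ℓ) {p : ℕ} (prime : Prime p)
  (p·1≈0 : CommutativeRing._≈_ S (Mult._×_ (CommutativeRing.semiring S) p (CommutativeRing.1# S))
                                 (CommutativeRing.0# S)) where

  open CommutativeRing S hiding (zero)
  open Exp semiring using (_^_)
  open Mult semiring renaming (_×_ to _·_)
  open Sum semiring using (sum; sum-init-last; sum-cong-≋; sum-replicate-zero)
  open RingProperties ring
  open import Relation.Binary.Reasoning.Setoid setoid

  [j*k]·x≈j·1*[k·1*x] : ∀ j k x → (j ℕ.* k) · x ≈ (j · 1#) * ((k · 1#) * x)
  [j*k]·x≈j·1*[k·1*x] j k x = begin
    (j ℕ.* k) · x                ≈⟨ ×-congʳ (j ℕ.* k) (*-identityˡ x) ⟨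
    (j ℕ.* k) · (1# * x)         ≈⟨ ×-assoc-* (j ℕ.* k) 1# x ⟨
    ((j ℕ.* k) · 1#) * x         ≈⟨ *-congʳ (×1-homo-* j k) ⟩
    (j · 1#) * (k · 1#) * x      ≈⟨ *-assoc _ _ _ ⟩
    (j · 1#) * ((k · 1#) * x)    ∎

  annihilates : ∀ {k x} → (k · 1#) * x ≈ 0# → ∀ j → (j ℕ.* k) · x ≈ 0#
  annihilates {k} {x} kx≈0 j = begin
    (j ℕ.* k) · x                ≈⟨ [j*k]·x≈j·1*[k·1*x] j k x ⟩
    (j · 1#) * ((k · 1#) * x)    ≈⟨ *-congˡ kx≈0 ⟩
    (j · 1#) * 0#                ≈⟨ zeroʳ _ ⟩
    0#                           ∎

  p∣k⇒k·x≈0 : ∀ {k} → p ℕ.∣ k → ∀ x → k · x ≈ 0#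
  p∣k⇒k·x≈0 (ℕ.divides q ≡.refl) x = annihilates (trans (*-congʳ p·1≈0) (zeroˡ x)) q

  -- The exponent is a variable of its own, so that matching on `suc` exposes the first and the last
  -- binomial term; all terms between them are multiples of `p`.
  freshmansDream : ∀ n .{{_ : NonZero n}} → (∀ {k} → 0 < k → k < n → p ℕ.∣ n C k) →
                   ∀ x y → (x + y) ^ n ≈ x ^ n + y ^ n
  freshmansDream (suc n) p∣C x y = begin
    (x + y) ^ suc n
      ≈⟨ Binomial.theorem commutativeSemiring (suc n) x y ⟩
    term Fin.zero + sum (term ∘ Fin.suc)
      ≈⟨ +-cong first (sum-init-last (term ∘ Fin.suc)) ⟩
    y ^ suc n + (sum {n} (term ∘ Fin.suc ∘ inject₁) + term (Fin.suc (fromℕ n)))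
      ≈⟨ +-congˡ (+-cong middle final) ⟩
    y ^ suc n + (0# + x ^ suc n)
      ≈⟨ +-congˡ (+-identityˡ _) ⟩
    y ^ suc n + x ^ suc n
      ≈⟨ +-comm _ _ ⟩
    x ^ suc n + y ^ suc n ∎
    where
    term = Binomial.binomialTerm commutativeSemiring x y (suc n)

    first : term Fin.zero ≈ y ^ suc n
    first = trans (×-homo-1 _) (*-identityˡ _)

    middle : sum {n} (term ∘ Fin.suc ∘ inject₁) ≈ 0#
    middle = trans
      (sum-cong-≋ {n} λ k → p∣k⇒k·x≈0
        (p∣C z<s (s≤s (≡.subst (_< n) (≡.sym (Fin.toℕ-inject₁ k)) (Fin.toℕ<n k)))) _)
      (sum-replicate-zero n)

    final : term (Fin.suc (fromℕ n)) ≈ x ^ suc n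
    final rewrite Fin.toℕ-fromℕ n | ℕ.nCn≡1 (suc n) | ℕ.n∸n≡0 n =
      trans (×-homo-1 _) (*-identityʳ _)

  frobenius : ∀ x y → (x + y) ^ p ≈ x ^ p + y ^ p
  frobenius = freshmansDream p {{prime⇒nonZero prime}} (prime∣C prime)

  1^n≈1 : ∀ n → 1# ^ n ≈ 1#
  1^n≈1 zero    = refl
  1^n≈1 (suc n) = trans (*-identityˡ _) (1^n≈1 n)

  0^n≈0 : ∀ n .{{_ : NonZero n}} → 0# ^ n ≈ 0#
  0^n≈0 (suc n) = zeroˡ _

  fermat : ∀ n → (n · 1#) ^ p ≈ n · 1#
  fermat zero    = 0^n≈0 p {{prime⇒nonZero prime}}
  fermat (suc n) = begin
    (1# + n · 1#) ^ p         ≈⟨ frobenius 1# (n · 1#) ⟩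
    1# ^ p + (n · 1#) ^ p     ≈⟨ +-cong (1^n≈1 p) (fermat n) ⟩
    1# + n · 1#               ∎

  -- A Bézout relation inverts `k` modulo `p`; its two possible signs give the two cases.
  cancel : ∀ {k x} → 0 < k → k < p → (k · 1#) * x ≈ 0# → x ≈ 0#
  cancel {k@(suc _)} {x} _ k<p kx≈0
    with Coprimality.coprime-Bézout (Coprimality.prime⇒coprime prime k<p)
  ... | Bézout.+- i j 1+jk≡ip = begin
    x                       ≈⟨ +-identityʳ x ⟨
    x + 0#                  ≈⟨ +-congˡ (annihilates kx≈0 j) ⟨
    (1 ℕ.+ j ℕ.* k) · x     ≈⟨ ×-congˡ 1+jk≡ip ⟩
    (i ℕ.* p) · x           ≈⟨ p∣k⇒k·x≈0 (ℕ.n∣m*n i) x ⟩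
    0#                      ∎
  ... | Bézout.-+ i j 1+ip≡jk = begin
    x                       ≈⟨ +-identityʳ x ⟨
    x + 0#                  ≈⟨ +-congˡ (p∣k⇒k·x≈0 (ℕ.n∣m*n i) x) ⟨
    (1 ℕ.+ i ℕ.* p) · x     ≈⟨ ×-congˡ 1+ip≡jk ⟩
    (j ℕ.* k) · x           ≈⟨ annihilates kx≈0 j ⟩
    0#                      ∎

  -- The Newton form with nodes a, a + 1, … of a monic polynomial; its leading coefficient 1 is not stored.
  newton : ∀ {n} → ℕ → Vec Carrier n → Carrier → Carrier
  newton a []       x = 1#
  newton a (c ∷ cs) x = c + (x - a · 1#) * newton (suc a) cs x

  falling : ℕ → ℕ → Carrier → Carrier
  falling a zero    x = 1#
  falling a (suc n) x = (x - a · 1#) * falling (suc a) n x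

  addConstant : ∀ {n} → Carrier → Vec Carrier (suc n) → Vec Carrier (suc n)
  addConstant c (d ∷ ds) = c + d ∷ ds

  -- Multiplication by x in Newton form: x (c + (x - a) t) = c a + (x - a) (c + x t).
  shift : ∀ {n} → ℕ → Vec Carrier n → Vec Carrier (suc n)
  shift a []       = a · 1# ∷ []
  shift a (c ∷ cs) = c * (a · 1#) ∷ addConstant c (shift (suc a) cs)

  newton-addConstant : ∀ {n} a c (ds : Vec Carrier (suc n)) x →
                       newton a (addConstant c ds) x ≈ c + newton a ds x
  newton-addConstant a c (d ∷ ds) x = +-assoc c d _

  y+[x-y]≈x : ∀ x y → y + (x - y) ≈ x
  y+[x-y]≈x x y = begin
    y + (x - y)     ≈⟨ +-congˡ (+-comm x (- y)) ⟩
    y + (- y + x)   ≈⟨ +-assoc y (- y) x ⟨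
    (y - y) + x     ≈⟨ +-congʳ (-‿inverseʳ y) ⟩
    0# + x          ≈⟨ +-identityˡ x ⟩
    x               ∎

  newton-shift : ∀ {n} a (cs : Vec Carrier n) x → newton a (shift a cs) x ≈ x * newton a cs x
  newton-shift a []       x = begin
    a · 1# + (x - a · 1#) * 1#   ≈⟨ +-congˡ (*-identityʳ _) ⟩
    a · 1# + (x - a · 1#)        ≈⟨ y+[x-y]≈x x (a · 1#) ⟩
    x                            ≈⟨ *-identityʳ x ⟨
    x * 1#                       ∎
  newton-shift a (c ∷ cs) x = begin
    c * α + (x - α) * newton (suc a) (addConstant c (shift (suc a) cs)) x
      ≈⟨ +-congˡ (*-congˡ (newton-addConstant (suc a) c (shift (suc a) cs) x)) ⟩
    c * α + (x - α) * (c + newton (suc a) (shift (suc a) cs) x)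
      ≈⟨ +-congˡ (*-congˡ (+-congˡ (newton-shift (suc a) cs x))) ⟩
    c * α + (x - α) * (c + x * t)
      ≈⟨ +-congˡ (distribˡ _ _ _) ⟩
    c * α + ((x - α) * c + (x - α) * (x * t))
      ≈⟨ +-assoc _ _ _ ⟨
    (c * α + (x - α) * c) + (x - α) * (x * t)
      ≈⟨ +-cong head tail ⟩
    x * c + x * ((x - α) * t)
      ≈⟨ distribˡ x c _ ⟨
    x * (c + (x - α) * t) ∎
    where
    α = a · 1#
    t = newton (suc a) cs x

    head : c * α + (x - α) * c ≈ x * c
    head = begin
      c * α + (x - α) * c   ≈⟨ +-congʳ (*-comm c α) ⟩
      α * c + (x - α) * c   ≈⟨ distribʳ c α (x - α) ⟨
      (α + (x - α)) * c     ≈⟨ *-congʳ (y+[x-y]≈x x α) ⟩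
      x * c                 ∎

    tail : (x - α) * (x * t) ≈ x * ((x - α) * t)
    tail = begin
      (x - α) * (x * t)     ≈⟨ *-assoc _ _ _ ⟨
      (x - α) * x * t       ≈⟨ *-congʳ (*-comm _ _) ⟩
      x * (x - α) * t       ≈⟨ *-assoc _ _ _ ⟩
      x * ((x - α) * t)     ∎

  powerCoefficients : ∀ n → Vec Carrier n
  powerCoefficients zero    = []
  powerCoefficients (suc n) = shift 0 (powerCoefficients n)

  newton-power : ∀ n x → newton 0 (powerCoefficients n) x ≈ x ^ n
  newton-power zero    x = refl
  newton-power (suc n) x = trans (newton-shift 0 (powerCoefficients n) x) (*-congˡ (newton-power n x))

  [1+a+i]·1-a·1≈[1+i]·1 : ∀ a i → (suc a ℕ.+ i) · 1# - a · 1# ≈ suc i · 1#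
  [1+a+i]·1-a·1≈[1+i]·1 a i = begin
    (suc a ℕ.+ i) · 1# - a · 1#            ≈⟨ +-congʳ (×-congˡ (ℕ.+-comm (suc a) i)) ⟩
    (i ℕ.+ suc a) · 1# - a · 1#            ≈⟨ +-congʳ (×-congˡ (ℕ.+-suc i a)) ⟩
    (suc i ℕ.+ a) · 1# - a · 1#            ≈⟨ +-congʳ (×-homo-+ 1# (suc i) a) ⟩
    suc i · 1# + a · 1# - a · 1#           ≈⟨ +-assoc _ _ _ ⟩
    suc i · 1# + (a · 1# - a · 1#)         ≈⟨ +-congˡ (-‿inverseʳ _) ⟩
    suc i · 1# + 0#                        ≈⟨ +-identityʳ _ ⟩
    suc i · 1#                             ∎

  -- At the node a every term but `c` vanishes, so `c` is zero. At a later node the factor x - a is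
  -- an integer strictly between 0 and `p`, which can be cancelled, so the remaining form vanishes
  -- at the remaining nodes. In the end only the implicit leading term is left.
  newton-vanishing : ∀ {n} a (cs : Vec Carrier n) → n ≤ p →
                     (∀ {i} → i < n → newton a cs ((a ℕ.+ i) · 1#) ≈ 0#) →
                     ∀ x → newton a cs x ≈ falling a n x
  newton-vanishing a []       _   _ x = refl
  newton-vanishing {suc n} a (c ∷ cs) n<p cs≈0 x = begin
    c + (x - a · 1#) * newton (suc a) cs x   ≈⟨ +-cong c≈0 (*-congˡ rest) ⟩
    0# + (x - a · 1#) * falling (suc a) n x  ≈⟨ +-identityˡ _ ⟩
    (x - a · 1#) * falling (suc a) n x       ∎
    where
    c≈0 : c ≈ 0#
    c≈0 = begin
      c                                      ≈⟨ +-identityʳ c ⟨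
      c + 0#                                 ≈⟨ +-congˡ (zeroˡ _) ⟨
      c + 0# * newton (suc a) cs α           ≈⟨ +-congˡ (*-congʳ α-a≈0) ⟨
      c + (α - a · 1#) * newton (suc a) cs α ≈⟨ cs≈0 z<s ⟩
      0#                                     ∎
      where
      α = (a ℕ.+ 0) · 1#
      α-a≈0 : α - a · 1# ≈ 0#
      α-a≈0 = trans (+-congʳ (×-congˡ (ℕ.+-identityʳ a))) (-‿inverseʳ _)

    rest : newton (suc a) cs x ≈ falling (suc a) n x
    rest = newton-vanishing (suc a) cs (ℕ.<⇒≤ n<p) (λ {i} i<n →
      cancel {suc i} z<s (ℕ.<-≤-trans (s≤s i<n) n<p) (begin
        (suc i · 1#) * newton (suc a) cs (β i)           ≈⟨ *-congʳ ([1+a+i]·1-a·1≈[1+i]·1 a i) ⟨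
        (β i - a · 1#) * newton (suc a) cs (β i)         ≈⟨ +-identityˡ _ ⟨
        0# + (β i - a · 1#) * newton (suc a) cs (β i)    ≈⟨ +-congʳ c≈0 ⟨
        newton a (c ∷ cs) (β i)                          ≡⟨ ≡.cong (λ m → newton a (c ∷ cs) (m · 1#)) (≡.sym (ℕ.+-suc a i)) ⟩
        newton a (c ∷ cs) ((a ℕ.+ suc i) · 1#)           ≈⟨ cs≈0 (s≤s i<n) ⟩
        0#                                               ∎)) x
      where
      β : ℕ → Carrier
      β i = (suc a ℕ.+ i) · 1#

  -- The first node is 0, so x is itself a Newton basis element and only the second coefficient
  -- changes. Degree at least 2 keeps that coefficient distinct from the implicit leading 1.
  subtractVariable : ∀ {n} → Vec Carrier (suc (suc n)) → Vec Carrier (suc (suc n))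
  subtractVariable (c₀ ∷ c₁ ∷ cs) = c₀ ∷ addConstant (- 1#) (c₁ ∷ cs)

  newton-subtractVariable : ∀ {n} (cs : Vec Carrier (suc (suc n))) x →
                            newton 0 (subtractVariable cs) x ≈ newton 0 cs x - x
  newton-subtractVariable (c ∷ d ∷ ds) x = begin
    c + y * newton 1 (addConstant (- 1#) (d ∷ ds)) x  ≈⟨ +-congˡ (*-congˡ (newton-addConstant 1 (- 1#) (d ∷ ds) x)) ⟩
    c + y * (- 1# + t)                                ≈⟨ +-congˡ (distribˡ y (- 1#) t) ⟩
    c + (y * - 1# + y * t)                            ≈⟨ +-congˡ (+-comm _ _) ⟩
    c + (y * t + y * - 1#)                            ≈⟨ +-assoc _ _ _ ⟨
    c + y * t + y * - 1#                              ≈⟨ +-congˡ (-‿distribʳ-* y 1#) ⟨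
    c + y * t - y * 1#                                ≈⟨ +-congˡ (-‿cong (trans (*-identityʳ y) y≈x)) ⟩
    c + y * t - x                                     ∎
    where
    y = x - 0 · 1#
    t = newton 1 (d ∷ ds) x

    y≈x : y ≈ x
    y≈x = trans (+-congˡ -0#≈0#) (+-identityʳ x)

  falling≈x^p-x : ∀ x → falling 0 p x ≈ x ^ p - x
  falling≈x^p-x x = go (ℕ.nonTrivial⇒n>1 p {{prime⇒nonTrivial prime}}) ℕ.≤-refl fermat
    where
    -- `p` is a module parameter; the exponent is generalised to `n` so that it can be matched as a
    -- number at least 2, as `subtractVariable` requires.
    go : ∀ {n} → 1 < n → n ≤ p → (∀ k → (k · 1#) ^ n ≈ k · 1#) → falling 0 n x ≈ x ^ n - x
    go {suc zero}    (s≤s ())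
    go {suc (suc n)} _ n≤p power = trans
      (sym (newton-vanishing 0 cs n≤p (λ {i} _ →
        trans (expand (i · 1#)) (x≈y⇒x-y≈0 (power i))) x))
      (expand x)
      where
      cs = subtractVariable (powerCoefficients (suc (suc n)))
      expand : ∀ y → newton 0 cs y ≈ y ^ suc (suc n) - y
      expand y = trans (newton-subtractVariable (powerCoefficients (suc (suc n))) y)
                       (+-congʳ (newton-power (suc (suc n)) y))
      x≈y⇒x-y≈0 : ∀ {x y} → x ≈ y → x - y ≈ 0#
      x≈y⇒x-y≈0 x≈y = trans (+-congʳ x≈y) (-‿inverseʳ _)

  -- Zero divisors among the factors of x ^ p - x

  falling-+ : ∀ i m n x → falling i (m ℕ.+ n) x ≈ falling i m x * falling (i ℕ.+ m) n x
  falling-+ i zero    n x = begin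
    falling i n x                     ≡⟨ ≡.cong (λ j → falling j n x) (ℕ.+-identityʳ i) ⟨
    falling (i ℕ.+ 0) n x             ≈⟨ *-identityˡ _ ⟨
    1# * falling (i ℕ.+ 0) n x        ∎
  falling-+ i (suc m) n x = begin
    (x - i · 1#) * falling (suc i) (m ℕ.+ n) x
      ≈⟨ *-congˡ (falling-+ (suc i) m n x) ⟩
    (x - i · 1#) * (falling (suc i) m x * falling (suc i ℕ.+ m) n x)
      ≈⟨ *-assoc _ _ _ ⟨
    (x - i · 1#) * falling (suc i) m x * falling (suc i ℕ.+ m) n x
      ≡⟨ ≡.cong (λ j → (x - i · 1#) * falling (suc i) m x * falling j n x) (ℕ.+-suc i m) ⟨
    (x - i · 1#) * falling (suc i) m x * falling (i ℕ.+ suc m) n x ∎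

  module ZeroDivisors {r} (x : Carrier) {Root : ℕ → Set r} (root? : ∀ j → Dec (Root j))
    (regular : ∀ {j} → ¬ Root j → ∀ {y} → (x - j · 1#) * y ≈ 0# → y ≈ 0#) where

    -- Regular factors are cancelled from the product one at a time; the process stops at a root or
    -- exhausts the product and leaves `y ≈ 0#`.
    falling-regular : ∀ i n y → falling i n x * y ≈ 0# →
                      y ≈ 0# ⊎ (∃[ j ] i ≤ j × j < i ℕ.+ n × Root j)
    falling-regular i zero    y eq = inj₁ (trans (sym (*-identityˡ y)) eq)
    falling-regular i (suc n) y eq with root? i
    ... | yes root = inj₂ (i , ℕ.≤-refl , ℕ.m<m+n i z<s , root)
    ... | no ¬root with falling-regular (suc i) n y (regular ¬root (trans (sym (*-assoc _ _ _)) eq))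
    ...   | inj₁ y≈0 = inj₁ y≈0
    ...   | inj₂ (j , i<j , j<i+n , root) =
              inj₂ (j , ℕ.<⇒≤ i<j , ≡.subst (j <_) (≡.sym (ℕ.+-suc i n)) j<i+n , root)

    -- If every factor of the vanishing product were regular, 1 would be zero, so there is a root i.
    -- The factor x - i is then set aside as the annihilated element; since it is nonzero, the
    -- factors below i or those above i must contain another root.
    twoRoots : ¬ (1# ≈ 0#) → (∀ j → ¬ (x - j · 1# ≈ 0#)) → x ^ p ≈ x →
               ∃[ i ] ∃[ j ] (i < p × j < p × ¬ (i ≡ j) × Root i × Root j)
    twoRoots 1≉0 factor≉0 x^p≈x
      with falling-regular 0 p 1# (trans (*-identityʳ _) falling≈0)
      where
      falling≈0 : falling 0 p x ≈ 0#
      falling≈0 = trans (falling≈x^p-x x) (trans (+-congʳ x^p≈x) (-‿inverseʳ x))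
    ... | inj₁ 1≈0 = contradiction 1≈0 1≉0
    ... | inj₂ (i , _ , i<p , root-i) = second
      where
      n = p ℕ.∸ suc i

      1+i+n≡p : suc i ℕ.+ n ≡ p
      1+i+n≡p = ℕ.m+[n∸m]≡n i<p

      product≈0 : falling 0 i x * (falling (suc i) n x * (x - i · 1#)) ≈ 0#
      product≈0 = begin
        falling 0 i x * (falling (suc i) n x * (x - i · 1#))   ≈⟨ *-congˡ (*-comm _ _) ⟩
        falling 0 i x * ((x - i · 1#) * falling (suc i) n x)   ≈⟨ falling-+ 0 i (suc n) x ⟨
        falling 0 (i ℕ.+ suc n) x                              ≡⟨ ≡.cong (λ k → falling 0 k x) (≡.trans (ℕ.+-suc i n) 1+i+n≡p) ⟩
        falling 0 p x                                          ≈⟨ falling≈x^p-x x ⟩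
        x ^ p - x                                              ≈⟨ +-congʳ x^p≈x ⟩
        x - x                                                  ≈⟨ -‿inverseʳ x ⟩
        0#                                                     ∎

      second : ∃[ i ] ∃[ j ] (i < p × j < p × ¬ (i ≡ j) × Root i × Root j)
      second with falling-regular 0 i _ product≈0
      ... | inj₂ (j , _ , j<i , root-j) =
              i , j , i<p , ℕ.<-trans j<i i<p , (λ i≡j → ℕ.<⇒≢ j<i (≡.sym i≡j)) , root-i , root-j
      ... | inj₁ eq with falling-regular (suc i) n _ eq
      ...   | inj₁ factor≈0 = contradiction factor≈0 (factor≉0 i)
      ...   | inj₂ (j , i<j , j<1+i+n , root-j) =
                i , j , i<p , ≡.subst (j <_) 1+i+n≡p j<1+i+n , ℕ.<⇒≢ i<j , root-i , root-j

open import Defs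
open import Algebra.Consequences.Setoid using (comm∧idˡ⇒id; comm∧distrˡ⇒distr)
import Algebra.Construct.DirectProduct as DirectProduct
open import Data.Fin.Patterns using (0F; 1F; 2F)
open import Data.Integer using (ℤ; +_; -[1+_]; 0ℤ; 1ℤ; -1ℤ; -_; _+_; _-_; _*_; _^_; _/_; _/ℕ_; _%ℕ_; +-0-rawMonoid)
  renaming (∣_∣ to abs)
open import Data.Integer.Divisibility.Signed
  using (_∣_; _∣?_; divides; ∣-refl; ∣m∣n⇒∣m+n; ∣n⇒∣m*n; ∣m⇒∣m*n; ∣m⇒∣-m; ∣⇒∣ᵤ; ∣ᵤ⇒∣)
import Data.Integer.DivMod as ℤ
import Data.Integer.Properties as ℤ
open import Data.Integer.Solver using (module +-*-Solver)
open import Data.Integer.Tactic.RingSolver using (solve-∀)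
open import Data.List using (length; upTo)
open import Data.List.Membership.Propositional using (_∈_)
open import Data.List.Membership.Propositional.Properties using (∈-filter⁺; ∈-filter⁻; ∈-upTo⁺; ∈-upTo⁻)
open import Data.List.Membership.Propositional.Properties.WithK using (unique∧set⇒bag)
open import Data.List.Relation.Binary.BagAndSetEquality using (∼bag⇒↭)
open import Data.List.Relation.Binary.Permutation.Propositional.Properties using (↭-length)
open import Data.List.Relation.Unary.Any using (here; there)
open import Data.List.Relation.Unary.Unique.Propositional using (Unique)
open import Data.List.Relation.Unary.Unique.Propositional.Properties using (filter⁺; upTo⁺)
open import Relation.Binary.PropositionalEquality using (refl; sym; trans; cong; cong₂; subst; subst₂)
open import Algebra.Definitions.RawMonoid +-0-rawMonoid using (sum)
open import Algebra.Properties.Monoid.Sum ℤ.+-0-monoid using (sum-cong-≗)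
open import Algebra.Properties.Ring ℤ.+-*-ring using (+-cancelʳ)

-- Residue rings and their cubic extensions

-- The common shape of the divisibility proofs: an explicit linear combination of known multiples,
-- whose identity the ring solver checks.
combine₂ : ∀ {m x y z} → m ∣ x → m ∣ y → ∀ k l → z ≡ k * x + l * y → m ∣ z
combine₂ m∣x m∣y k l refl = ∣m∣n⇒∣m+n (∣n⇒∣m*n k m∣x) (∣n⇒∣m*n l m∣y)

combine₃ : ∀ {m x y z w} → m ∣ x → m ∣ y → m ∣ z → ∀ i j k → w ≡ i * x + j * y + k * z → m ∣ w
combine₃ m∣x m∣y m∣z i j k refl = ∣m∣n⇒∣m+n (combine₂ m∣x m∣y i j refl) (∣n⇒∣m*n k m∣z)

∣-swap : ∀ {m} x y → m ∣ x - y → m ∣ y - x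
∣-swap {m} x y m∣x-y = subst (m ∣_) (identity x y) (∣m⇒∣-m m∣x-y)
  where
  identity : ∀ x y → - (x - y) ≡ y - x
  identity = solve-∀

module Residues (m : ℕ) where

  infix 4 _≈_

  -- A record, because unification cannot recover `x` and `y` from the divisibility of their
  -- difference.
  record _≈_ (x y : ℤ) : Set where
    constructor congruent
    field difference : x ≡ y [mod m ]

  open _≈_ public

  ≡⇒≈ : ∀ {x y} → x ≡ y → x ≈ y
  ≡⇒≈ {x} refl = congruent (divides 0ℤ (ℤ.+-inverseʳ x))

  ≈-sym : ∀ {x y} → x ≈ y → y ≈ x
  ≈-sym {x} {y} (congruent d) = congruent (∣-swap x y d)

  ≈-trans : ∀ {x y z} → x ≈ y → y ≈ z → x ≈ z
  ≈-trans {x} {y} {z} (congruent d) (congruent e) = congruent (combine₂ d e 1ℤ 1ℤ (identity x y z))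
    where
    identity : ∀ x y z → x - z ≡ 1ℤ * (x - y) + 1ℤ * (y - z)
    identity = solve-∀

  +-cong : ∀ {x y u v} → x ≈ y → u ≈ v → x + u ≈ y + v
  +-cong {x} {y} {u} {v} (congruent d) (congruent e) =
    congruent (combine₂ d e 1ℤ 1ℤ (identity x y u v))
    where
    identity : ∀ x y u v → (x + u) - (y + v) ≡ 1ℤ * (x - y) + 1ℤ * (u - v)
    identity = solve-∀

  *-cong : ∀ {x y u v} → x ≈ y → u ≈ v → x * u ≈ y * v
  *-cong {x} {y} {u} {v} (congruent d) (congruent e) =
    congruent (combine₂ d e u y (identity x y u v))
    where
    identity : ∀ x y u v → (x * u) - (y * v) ≡ u * (x - y) + y * (u - v)
    identity = solve-∀

  -‿cong : ∀ {x y} → x ≈ y → - x ≈ - y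
  -‿cong {x} {y} (congruent d) = congruent (subst (+ m ∣_) (identity x y) (∣m⇒∣-m d))
    where
    identity : ∀ x y → - (x - y) ≡ - x - - y
    identity = solve-∀

  sub-cong : ∀ {x y u v} → x ≈ y → u ≈ v → x - u ≈ y - v
  sub-cong x≈y u≈v = +-cong x≈y (-‿cong u≈v)

  commutativeRing : CommutativeRing 0ℓ 0ℓ
  commutativeRing = record
    { _≈_ = _≈_ ; _+_ = _+_ ; _*_ = _*_ ; -_ = -_ ; 0# = 0ℤ ; 1# = 1ℤ
    ; isCommutativeRing = record
      { isRing = record
        { +-isAbelianGroup = record
          { isGroup = record
            { isMonoid = record
              { isSemigroup = record
                { isMagma = record
                  { isEquivalence = record { refl = ≡⇒≈ refl ; sym = ≈-sym ; trans = ≈-trans }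
                  ; ∙-cong = +-cong
                  }
                ; assoc = λ x y z → ≡⇒≈ (ℤ.+-assoc x y z)
                }
              ; identity = (λ x → ≡⇒≈ (ℤ.+-identityˡ x)) , (λ x → ≡⇒≈ (ℤ.+-identityʳ x))
              }
            ; inverse = (λ x → ≡⇒≈ (ℤ.+-inverseˡ x)) , (λ x → ≡⇒≈ (ℤ.+-inverseʳ x))
            ; ⁻¹-cong = -‿cong
            }
          ; comm = λ x y → ≡⇒≈ (ℤ.+-comm x y)
          }
        ; *-cong = *-cong
        ; *-assoc = λ x y z → ≡⇒≈ (ℤ.*-assoc x y z)
        ; *-identity = (λ x → ≡⇒≈ (ℤ.*-identityˡ x)) , (λ x → ≡⇒≈ (ℤ.*-identityʳ x))
        ; distrib = (λ x y z → ≡⇒≈ (ℤ.*-distribˡ-+ x y z)) , (λ x y z → ≡⇒≈ (ℤ.*-distribʳ-+ x y z))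
        }
      ; *-comm = λ x y → ≡⇒≈ (ℤ.*-comm x y)
      }
    }

-- A triple (r₀ , r₁ , r₂) stands for r₀ + r₁ x + r₂ x² modulo x³ + a x + b.
-- The operations are parameters so that the ring solver can run on the same formulas.
module Coordinates {A : Set} (_⊕_ _⊖_ _⊗_ : A → A → A) where

  infixl 6 _⊞_ _⊟_
  infixl 7 _⊠_

  private
    _⊞_ = _⊕_
    _⊟_ = _⊖_
    _⊠_ = _⊗_

  coordinate : Fin 3 → A × A × A → A
  coordinate 0F (x , _ , _) = x
  coordinate 1F (_ , x , _) = x
  coordinate 2F (_ , _ , x) = x

  plus : A × A × A → A × A × A → A × A × A
  plus (x₀ , x₁ , x₂) (y₀ , y₁ , y₂) = x₀ ⊞ y₀ , x₁ ⊞ y₁ , x₂ ⊞ y₂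

  times : A → A → A × A × A → A × A × A → A × A × A
  times a b (x₀ , x₁ , x₂) (y₀ , y₁ , y₂) =
    x₀ ⊠ y₀ ⊟ b ⊠ (x₁ ⊠ y₂ ⊞ x₂ ⊠ y₁) ,
    x₀ ⊠ y₁ ⊞ x₁ ⊠ y₀ ⊟ a ⊠ (x₁ ⊠ y₂ ⊞ x₂ ⊠ y₁) ⊟ b ⊠ (x₂ ⊠ y₂) ,
    x₀ ⊠ y₂ ⊞ x₁ ⊠ y₁ ⊞ x₂ ⊠ y₀ ⊟ a ⊠ (x₂ ⊠ y₂)

  -- The determinant of multiplication by the triple; over a splitting field, the product of its
  -- values at the three roots. `con` embeds the integer constants.
  norm : (ℤ → A) → A → A → A × A × A → A
  norm con a b (x , y , z) =
    x ⊠ x ⊠ x ⊟ b ⊠ (y ⊠ y ⊠ y) ⊞ b ⊠ b ⊠ (z ⊠ z ⊠ z)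
    ⊟ con (+ 2) ⊠ a ⊠ (x ⊠ x ⊠ z) ⊞ a ⊠ (x ⊠ y ⊠ y) ⊞ a ⊠ a ⊠ (x ⊠ z ⊠ z)
    ⊟ a ⊠ b ⊠ (y ⊠ z ⊠ z) ⊞ con (+ 3) ⊠ b ⊠ (x ⊠ y ⊠ z)

module Integral = Coordinates _+_ _-_ _*_
open Integral using (coordinate; plus; times; norm)

module _ where
  open +-*-Solver using (Polynomial; solve; con; _:+_; _:-_; _:*_; _:=_)
  module Symbolic {n} = Coordinates {Polynomial n} _:+_ _:-_ _:*_

  times-comm : ∀ a b x y i → coordinate i (times a b x y) ≡ coordinate i (times a b y x)
  times-comm a b (x₀ , x₁ , x₂) (y₀ , y₁ , y₂) = λ where
      0F → solve 8 (equation 0F) refl a b x₀ x₁ x₂ y₀ y₁ y₂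
      1F → solve 8 (equation 1F) refl a b x₀ x₁ x₂ y₀ y₁ y₂
      2F → solve 8 (equation 2F) refl a b x₀ x₁ x₂ y₀ y₁ y₂
    where
    equation : Fin 3 → N-ary 8 (Polynomial 8) (Polynomial 8 × Polynomial 8)
    equation = λ i a b x₀ x₁ x₂ y₀ y₁ y₂ →
      let x = x₀ , x₁ , x₂
          y = y₀ , y₁ , y₂
      in Symbolic.coordinate i (Symbolic.times a b x y) := Symbolic.coordinate i (Symbolic.times a b y x)

  times-assoc : ∀ a b x y z i → coordinate i (times a b (times a b x y) z) ≡
                                coordinate i (times a b x (times a b y z))
  times-assoc a b (x₀ , x₁ , x₂) (y₀ , y₁ , y₂) (z₀ , z₁ , z₂) = λ where
      0F → solve 11 (equation 0F) refl a b x₀ x₁ x₂ y₀ y₁ y₂ z₀ z₁ z₂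
      1F → solve 11 (equation 1F) refl a b x₀ x₁ x₂ y₀ y₁ y₂ z₀ z₁ z₂
      2F → solve 11 (equation 2F) refl a b x₀ x₁ x₂ y₀ y₁ y₂ z₀ z₁ z₂
    where
    equation : Fin 3 → N-ary 11 (Polynomial 11) (Polynomial 11 × Polynomial 11)
    equation = λ i a b x₀ x₁ x₂ y₀ y₁ y₂ z₀ z₁ z₂ →
      let x = x₀ , x₁ , x₂
          y = y₀ , y₁ , y₂
          z = z₀ , z₁ , z₂
          times = Symbolic.times a b
      in Symbolic.coordinate i (times (times x y) z) := Symbolic.coordinate i (times x (times y z))

  times-distribˡ-plus : ∀ a b x y z i → coordinate i (times a b x (plus y z)) ≡
                                        coordinate i (plus (times a b x y) (times a b x z))
  times-distribˡ-plus a b (x₀ , x₁ , x₂) (y₀ , y₁ , y₂) (z₀ , z₁ , z₂) = λ where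
      0F → solve 11 (equation 0F) refl a b x₀ x₁ x₂ y₀ y₁ y₂ z₀ z₁ z₂
      1F → solve 11 (equation 1F) refl a b x₀ x₁ x₂ y₀ y₁ y₂ z₀ z₁ z₂
      2F → solve 11 (equation 2F) refl a b x₀ x₁ x₂ y₀ y₁ y₂ z₀ z₁ z₂
    where
    equation : Fin 3 → N-ary 11 (Polynomial 11) (Polynomial 11 × Polynomial 11)
    equation = λ i a b x₀ x₁ x₂ y₀ y₁ y₂ z₀ z₁ z₂ →
      let x = x₀ , x₁ , x₂
          y = y₀ , y₁ , y₂
          z = z₀ , z₁ , z₂
          times = Symbolic.times a b
      in Symbolic.coordinate i (times x (Symbolic.plus y z)) :=
         Symbolic.coordinate i (Symbolic.plus (times x y) (times x z))

  times-identityˡ : ∀ a b x i → coordinate i (times a b (1ℤ , 0ℤ , 0ℤ) x) ≡ coordinate i x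
  times-identityˡ a b (x₀ , x₁ , x₂) = λ where
      0F → solve 5 (equation 0F) refl a b x₀ x₁ x₂
      1F → solve 5 (equation 1F) refl a b x₀ x₁ x₂
      2F → solve 5 (equation 2F) refl a b x₀ x₁ x₂
    where
    equation : Fin 3 → N-ary 5 (Polynomial 5) (Polynomial 5 × Polynomial 5)
    equation = λ i a b x₀ x₁ x₂ →
      let x = x₀ , x₁ , x₂
          1# = con 1ℤ , con 0ℤ , con 0ℤ
      in Symbolic.coordinate i (Symbolic.times a b 1# x) := Symbolic.coordinate i x

  -- A linear left factor is the form that the induction on powers of x + c consumes, and it keeps
  -- the solver's identity small.
  norm-times-linear : ∀ a b c x → norm id a b (times a b (c , 1ℤ , 0ℤ) x) ≡
                      norm id a b (c , 1ℤ , 0ℤ) * norm id a b x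
  norm-times-linear a b c (x₀ , x₁ , x₂) = solve 6 (λ a b c x₀ x₁ x₂ →
    let y = c , con 1ℤ , con 0ℤ
        x = x₀ , x₁ , x₂
        norm = Symbolic.norm con a b
    in norm (Symbolic.times a b y x) := norm y :* norm x) refl a b c x₀ x₁ x₂

module CubicResidues (m : ℕ) (a b : ℤ) where

  private
    module Base = Residues m

    baseGroup : AbelianGroup 0ℓ 0ℓ
    baseGroup = CommutativeRing.+-abelianGroup Base.commutativeRing

    module Product = AbelianGroup
      (DirectProduct.abelianGroup baseGroup (DirectProduct.abelianGroup baseGroup baseGroup))

  infix 4 _≈_

  record _≈_ (x y : ℤ × ℤ × ℤ) : Set where
    constructor pointwise
    field coordinates : x Product.≈ y

  open _≈_ public

  coordinatewise : ∀ {x y} → (∀ i → coordinate i x ≡ coordinate i y) → x ≈ y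
  coordinatewise eq = pointwise (Base.≡⇒≈ (eq 0F) , Base.≡⇒≈ (eq 1F) , Base.≡⇒≈ (eq 2F))

  times-cong : ∀ {x y u v} → x ≈ y → u ≈ v → times a b x u ≈ times a b y v
  times-cong (pointwise (x₀ , x₁ , x₂)) (pointwise (u₀ , u₁ , u₂)) = pointwise (
    sub-cong (*-cong x₀ u₀) (*-cong b≈b (+-cong (*-cong x₁ u₂) (*-cong x₂ u₁))) ,
    sub-cong (sub-cong (+-cong (*-cong x₀ u₁) (*-cong x₁ u₀))
                 (*-cong a≈a (+-cong (*-cong x₁ u₂) (*-cong x₂ u₁))))
         (*-cong b≈b (*-cong x₂ u₂)) ,
    sub-cong (+-cong (+-cong (*-cong x₀ u₂) (*-cong x₁ u₁)) (*-cong x₂ u₀))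
         (*-cong a≈a (*-cong x₂ u₂)))
    where
    open Base
    a≈a = ≡⇒≈ {a} refl
    b≈b = ≡⇒≈ {b} refl

  norm-cong : ∀ {x y} → x ≈ y → norm id a b x Base.≈ norm id a b y
  norm-cong (pointwise (x , y , z)) =
    +-cong (sub-cong (+-cong (+-cong (sub-cong (+-cong (sub-cong
      (*-cong (*-cong x x) x)
      (*-cong (≡⇒≈ {b} refl) (*-cong (*-cong y y) y)))
      (*-cong (≡⇒≈ {b * b} refl) (*-cong (*-cong z z) z)))
      (*-cong (≡⇒≈ {+ 2 * a} refl) (*-cong (*-cong x x) z)))
      (*-cong (≡⇒≈ {a} refl) (*-cong (*-cong x y) y)))
      (*-cong (≡⇒≈ {a * a} refl) (*-cong (*-cong x z) z)))
      (*-cong (≡⇒≈ {a * b} refl) (*-cong (*-cong y z) z)))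
      (*-cong (≡⇒≈ {+ 3 * b} refl) (*-cong (*-cong x y) z))
    where open Base

  commutativeRing : CommutativeRing 0ℓ 0ℓ
  commutativeRing = record
    { _≈_ = _≈_ ; _+_ = plus ; _*_ = times a b ; -_ = Product._⁻¹
    ; 0# = 0ℤ , 0ℤ , 0ℤ ; 1# = 1ℤ , 0ℤ , 0ℤ
    ; isCommutativeRing = record
      { isRing = record
        { +-isAbelianGroup = record
          { isGroup = record
            { isMonoid = record
              { isSemigroup = record
                { isMagma = record { isEquivalence = isEquivalence ; ∙-cong = plus-cong }
                ; assoc = λ x y z → pointwise (Product.assoc x y z)
                }
              ; identity = (λ x → pointwise (Product.identityˡ x)) , (λ x → pointwise (Product.identityʳ x))
              }
            ; inverse = (λ x → pointwise (Product.inverseˡ x)) , (λ x → pointwise (Product.inverseʳ x))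
            ; ⁻¹-cong = λ x≈y → pointwise (Product.⁻¹-cong (coordinates x≈y))
            }
          ; comm = λ x y → pointwise (Product.comm x y)
          }
        ; *-cong = times-cong
        ; *-assoc = λ x y z → coordinatewise (times-assoc a b x y z)
        ; *-identity = comm∧idˡ⇒id setoid times-commutative λ x → coordinatewise (times-identityˡ a b x)
        ; distrib = comm∧distrˡ⇒distr setoid plus-cong times-commutative
                      λ x y z → coordinatewise (times-distribˡ-plus a b x y z)
        }
      ; *-comm = times-commutative
      }
    }
    where
    isEquivalence : IsEquivalence _≈_
    isEquivalence = record
      { refl  = pointwise Product.refl
      ; sym   = λ x≈y → pointwise (Product.sym (coordinates x≈y))
      ; trans = λ x≈y y≈z → pointwise (Product.trans (coordinates x≈y) (coordinates y≈z))
      }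

    setoid : Setoid 0ℓ 0ℓ
    setoid = record { isEquivalence = isEquivalence }

    plus-cong : ∀ {x y u v} → x ≈ y → u ≈ v → plus x u ≈ plus y v
    plus-cong x≈y u≈v = pointwise (Product.∙-cong (coordinates x≈y) (coordinates u≈v))

    times-commutative : ∀ x y → times a b x y ≈ times a b y x
    times-commutative x y = coordinatewise (times-comm a b x y)

-- The discriminant of a depressed cubic

det-cong : ∀ {n} {M M′ : Matrix n} → (∀ i j → M i j ≡ M′ i j) → det M ≡ det M′
det-cong {zero}  M≗M′ = refl
det-cong {suc n} M≗M′ = sum-cong-≗ λ j → cong (-1ℤ ^ toℕ j *_)
  (cong₂ _*_ (M≗M′ Fin.zero j) (det-cong λ i k → M≗M′ (Fin.suc i) (punchIn j k)))

-- Symbolic counterparts of the definitions behind `resultant`, on which the ring solver can compute.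
module _ {k : ℕ} where
  open +-*-Solver using (Polynomial; con; ⟦_⟧; _:+_; _:*_)

  symbolicSum : ∀ {n} → Vector (Polynomial k) n → Polynomial k
  symbolicSum = Vector.foldr _:+_ (con 0ℤ)

  symbolicDet : ∀ {n} → Vector (Vector (Polynomial k) n) n → Polynomial k
  symbolicDet {zero}  _ = con 1ℤ
  symbolicDet {suc n} M = symbolicSum λ j →
    con (-1ℤ ^ toℕ j) :* (M Fin.zero j :* symbolicDet (λ i → removeAt (M (Fin.suc i)) j))

  symbolicShifted : ∀ {n} → ℕ → Vec (Polynomial k) n → ℕ → Polynomial k
  symbolicShifted (suc i) cs       zero    = con 0ℤ
  symbolicShifted (suc i) cs       (suc j) = symbolicShifted i cs j
  symbolicShifted zero    []       j       = con 0ℤ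
  symbolicShifted zero    (c ∷ cs) zero    = c
  symbolicShifted zero    (c ∷ cs) (suc j) = symbolicShifted zero cs j

  symbolicSylvester : ∀ {m n} → Vec (Polynomial k) (suc m) → Vec (Polynomial k) (suc n) →
                      Vector (Vector (Polynomial k) (n ℕ.+ m)) (n ℕ.+ m)
  symbolicSylvester {n = n} f g i j =
    [ (λ r → symbolicShifted (toℕ r) f (toℕ j)) , (λ r → symbolicShifted (toℕ r) g (toℕ j)) ] (splitAt n i)

  module _ (ρ : Vec ℤ k) where

    sum-⟦⟧ : ∀ {n} (t : Vector (Polynomial k) n) → sum (λ j → ⟦ t j ⟧ ρ) ≡ ⟦ symbolicSum t ⟧ ρ
    sum-⟦⟧ {zero}  t = refl
    sum-⟦⟧ {suc n} t = cong (λ s → ⟦ t Fin.zero ⟧ ρ + s) (sum-⟦⟧ (λ j → t (Fin.suc j)))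

    det-⟦⟧ : ∀ {n} (M : Vector (Vector (Polynomial k) n) n) →
             det (λ i j → ⟦ M i j ⟧ ρ) ≡ ⟦ symbolicDet M ⟧ ρ
    det-⟦⟧ {zero}  M = refl
    det-⟦⟧ {suc n} M = trans
      (sum-cong-≗ λ j → cong (λ d → -1ℤ ^ toℕ j * (⟦ M Fin.zero j ⟧ ρ * d))
        (det-⟦⟧ (λ i → removeAt (M (Fin.suc i)) j)))
      (sum-⟦⟧ (λ j → con (-1ℤ ^ toℕ j) :* (M Fin.zero j :* symbolicDet (λ i → removeAt (M (Fin.suc i)) j))))

    shifted-⟦⟧ : ∀ {n} i (cs : Vec (Polynomial k) n) j →
                 shifted i (map (λ c → ⟦ c ⟧ ρ) cs) j ≡ ⟦ symbolicShifted i cs j ⟧ ρ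
    shifted-⟦⟧ (suc i) cs       zero    = refl
    shifted-⟦⟧ (suc i) cs       (suc j) = shifted-⟦⟧ i cs j
    shifted-⟦⟧ zero    []       j       = refl
    shifted-⟦⟧ zero    (c ∷ cs) zero    = refl
    shifted-⟦⟧ zero    (c ∷ cs) (suc j) = shifted-⟦⟧ zero cs j

    resultant-⟦⟧ : ∀ {m n} (f : Vec (Polynomial k) (suc m)) (g : Vec (Polynomial k) (suc n)) →
                   resultant (map (λ c → ⟦ c ⟧ ρ) f) (map (λ c → ⟦ c ⟧ ρ) g) ≡
                   ⟦ symbolicDet (symbolicSylvester f g) ⟧ ρ
    resultant-⟦⟧ {m} {n} f g = trans (det-cong entry) (det-⟦⟧ (symbolicSylvester f g))
      where
      entry : ∀ i j → sylvester (map (λ c → ⟦ c ⟧ ρ) f) (map (λ c → ⟦ c ⟧ ρ) g) i j ≡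
              ⟦ symbolicSylvester f g i j ⟧ ρ
      entry i j with splitAt n i
      ... | inj₁ r = shifted-⟦⟧ (toℕ r) f (toℕ j)
      ... | inj₂ r = shifted-⟦⟧ (toℕ r) g (toℕ j)

resultant-cubic : ∀ a b → resultant (1ℤ ∷ 0ℤ ∷ a ∷ b ∷ []) (derivative (1ℤ ∷ 0ℤ ∷ a ∷ b ∷ [])) ≡
                          + 4 * (a * a * a) + + 27 * (b * b)
resultant-cubic a b = trans (resultant-⟦⟧ (a ∷ b ∷ []) f f′) (prove (a ∷ b ∷ [])
    (symbolicDet (symbolicSylvester f f′)) (con (+ 4) :* (A :* A :* A) :+ con (+ 27) :* (B :* B)) refl)
  where
  open +-*-Solver using (Polynomial; prove; con; var; _:+_; _:*_)
  A B : Polynomial 2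
  A = var Fin.zero
  B = var (Fin.suc Fin.zero)
  f : Vec (Polynomial 2) 4
  f = con 1ℤ ∷ con 0ℤ ∷ A ∷ B ∷ []
  f′ : Vec (Polynomial 2) 3
  -- The products stay unreduced so that their interpretations are definitionally the entries of
  -- `derivative`; `1ℤ * a` does not reduce to `a`.
  f′ = con (+ 3) :* con 1ℤ ∷ con (+ 2) :* con 0ℤ ∷ con 1ℤ :* A ∷ []

i/1≡i : ∀ i → i / 1ℤ ≡ i
i/1≡i i = trans (ℤ.div-pos-is-/ℕ i 1) (i/ℕ1≡i i)
  where
  i/ℕ1≡i : ∀ i → i /ℕ 1 ≡ i
  i/ℕ1≡i (+ n)    = cong +_ (ℕ.n/1≡n n)
  i/ℕ1≡i -[1+ n ] rewrite ℕ.n%1≡0 (suc n) | ℕ.n/1≡n (suc n) = refl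

disc-monic : ∀ {m} (cs : Vec ℤ (suc m)) → let f = 1ℤ ∷ cs in
             disc f ≡ -1ℤ ^ (suc m ℕ.* m ℕ./ 2) * resultant f (derivative f)
disc-monic {m} cs = i/1≡i (-1ℤ ^ (suc m ℕ.* m ℕ./ 2) * resultant (1ℤ ∷ cs) (derivative (1ℤ ∷ cs)))

disc-cubic : ∀ a b → let f = 1ℤ ∷ 0ℤ ∷ a ∷ b ∷ [] in disc f ≡ - (+ 4 * (a * a * a) + + 27 * (b * b))
disc-cubic a b = trans (disc-monic (0ℤ ∷ a ∷ b ∷ []))
  (trans (cong (-1ℤ *_) (resultant-cubic a b)) (ℤ.-1*i≡-i (+ 4 * (a * a * a) + + 27 * (b * b))))

-- Arithmetic modulo a prime

-- Duplicate-free lists with the same members are permutations of each other, so counting roots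
-- amounts to listing them.
N≡length : ∀ {n} p (f : Poly n) {xs} → Unique xs →
           (∀ {a} → (a ℕ.< p × + p ∣ eval f (+ a)) ⇔ (a ∈ xs)) → N p f ≡ length xs
N≡length p f unique roots = ↭-length (∼bag⇒↭ (unique∧set⇒bag (filter⁺ root? (upTo⁺ p)) unique (mk⇔
  (λ a∈ → let a∈p , f[a]≡0 = ∈-filter⁻ root? {xs = upTo p} a∈ in
          Equivalence.to roots (∈-upTo⁻ a∈p , f[a]≡0))
  (λ a∈ → let a<p , f[a]≡0 = Equivalence.from roots a∈ in
          ∈-filter⁺ root? (∈-upTo⁺ a<p) f[a]≡0))))
  where root? = λ a → + p ∣? eval f (+ a)

module PrimeDivisibility {p : ℕ} (prime : Prime p) where

  euclid : ∀ x y → + p ∣ x * y → + p ∣ x ⊎ + p ∣ y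
  euclid x y p∣xy with euclidsLemma (abs x) (abs y) prime (subst (p ℕ.∣_) (ℤ.abs-* x y) (∣⇒∣ᵤ p∣xy))
  ... | inj₁ p∣x = inj₁ (∣ᵤ⇒∣ p∣x)
  ... | inj₂ p∣y = inj₂ (∣ᵤ⇒∣ p∣y)

  cancelˡ : ∀ {x y} → ¬ (+ p ∣ x) → + p ∣ x * y → + p ∣ y
  cancelˡ {x} {y} p∤x p∣xy with euclid x y p∣xy
  ... | inj₁ p∣x = contradiction p∣x p∤x
  ... | inj₂ p∣y = p∣y

  square : ∀ {x} → + p ∣ x * x → + p ∣ x
  square {x} p∣xx with euclid x x p∣xx
  ... | inj₁ p∣x = p∣x
  ... | inj₂ p∣x = p∣x

  private
    toℤ : ∀ i m j n → 1 ℕ.+ i ℕ.* m ≡ j ℕ.* n → 1ℤ + + i * + m ≡ + j * + n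
    toℤ i m j n eq = trans (cong (λ z → 1ℤ + z) (sym (ℤ.pos-* i m))) (trans (cong +_ eq) (ℤ.pos-* j n))

    ordered : ∀ {a b} → a ℕ.≤ b → b ℕ.< p → + p ∣ + a - + b → b ℕ.≤ a
    ordered {a} {b} a≤b b<p p∣a-b with ∣⇒∣ᵤ p∣a-b
    ... | p∣ rewrite ℤ.m-n≡m⊖n a b | ℤ.∣⊖∣-≤ a≤b with b ℕ.∸ a in eq
    ...   | zero  = ℕ.m∸n≡0⇒m≤n eq
    ...   | suc k = contradiction (ℕ.∣⇒≤ p∣)
                      (ℕ.<⇒≱ (subst (ℕ._< p) eq (ℕ.≤-<-trans (ℕ.m∸n≤m b a) b<p)))

  residue-unique : ∀ {a b} → a ℕ.< p → b ℕ.< p → + p ∣ + a - + b → a ≡ b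
  residue-unique {a} {b} a<p b<p p∣a-b with ℕ.≤-total a b
  ... | inj₁ a≤b = ℕ.≤-antisym a≤b (ordered a≤b b<p p∣a-b)
  ... | inj₂ b≤a = ℕ.≤-antisym (ordered b≤a a<p (∣-swap (+ a) (+ b) p∣a-b)) b≤a

  reduce : ∀ x → ∃[ r ] (r ℕ.< p × + p ∣ x - + r)
  reduce x = x %ℕ p , ℤ.n%ℕd<d x p ,
             divides (x /ℕ p) (trans (cong (_- + (x %ℕ p)) (ℤ.a≡a%ℕn+[a/ℕn]*n x p))
                                     (identity (+ (x %ℕ p)) (x /ℕ p * + p)))
    where
    instance _ = prime⇒nonZero prime
    identity : ∀ r q → r + q - r ≡ q
    identity = solve-∀

  inverse : ∀ x → ¬ (+ p ∣ x) → ∃[ y ] (+ p ∣ x * y - 1ℤ)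
  inverse x p∤x with reduce x
  ... | zero      , _   , p∣x-r = contradiction (subst (+ p ∣_) (ℤ.+-identityʳ x) p∣x-r) p∤x
  ... | r@(suc _) , r<p , p∣x-r with Coprimality.coprime-Bézout (Coprimality.prime⇒coprime prime r<p)
  ...   | Bézout.+- i j 1+jr≡ip = - + j , combine₂ p∣x-r ∣-refl (- + j) (- + i)
          (trans (identity x (+ j) (+ r))
                 (trans (cong (λ z → - + j * (x - + r) + - z) (toℤ j r i p 1+jr≡ip))
                        (cong (λ z → - + j * (x - + r) + z) (ℤ.neg-distribˡ-* (+ i) (+ p)))))
    where
    identity : ∀ x j r → x * - j - 1ℤ ≡ - j * (x - r) + - (1ℤ + j * r)
    identity = solve-∀
  ...   | Bézout.-+ i j 1+ip≡jr = + j , combine₂ p∣x-r ∣-refl (+ j) (+ i)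
          (trans (identity x (+ j) (+ r))
                 (trans (cong (λ z → + j * (x - + r) + (z - 1ℤ)) (sym (toℤ i p j r 1+ip≡jr)))
                        (cancel (+ j * (x - + r)) (+ i * + p))))
    where
    identity : ∀ x j r → x * j - 1ℤ ≡ j * (x - r) + (j * r - 1ℤ)
    identity = solve-∀
    cancel : ∀ y z → y + (1ℤ + z - 1ℤ) ≡ y + z
    cancel = solve-∀

-- Depressed cubics modulo a prime

module DepressedCubic (a b : ℤ) where

  f : ℤ → ℤ
  f x = x * x * x + a * x + b

  D : ℤ
  D = - (+ 4 * (a * a * a) + + 27 * (b * b))

  module Roots {p : ℕ} (prime : Prime p) where
    open PrimeDivisibility prime

    module Pair r s (f[r]≡0 : + p ∣ f r) (f[s]≡0 : + p ∣ f s) (r≢s : ¬ (+ p ∣ r - s)) where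

      -- This is the divided difference (f r - f s) / (r - s).
      quotient : + p ∣ r * r + r * s + s * s + a
      quotient = cancelˡ r≢s (combine₂ f[r]≡0 f[s]≡0 1ℤ (- 1ℤ) (identity a b r s))
        where
        identity : ∀ a b r s → (r - s) * (r * r + r * s + s * s + a) ≡
                   1ℤ * (r * r * r + a * r + b) + - 1ℤ * (s * s * s + a * s + b)
        identity = solve-∀

      -- The missing x² term makes the sum of the roots zero.
      third : + p ∣ f (- (r + s))
      third = combine₂ f[r]≡0 quotient 1ℤ (- (r + s) - r) (identity a b r s)
        where
        identity : ∀ a b r s → let t = - (r + s) in
                   t * t * t + a * t + b ≡
                   1ℤ * (r * r * r + a * r + b) + (t - r) * (r * r + r * s + s * s + a)
        identity = solve-∀

      exhaustive : ∀ y → + p ∣ f y → + p ∣ y - r ⊎ + p ∣ y - s ⊎ + p ∣ y - - (r + s)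
      exhaustive y f[y]≡0 = ⊎.map₂ (euclid (y - s) (y - - (r + s)))
        (euclid (y - r) ((y - s) * (y - - (r + s)))
          (combine₃ f[y]≡0 quotient f[r]≡0 1ℤ (- (y - r)) (- 1ℤ) (identity a b r s y)))
        where
        identity : ∀ a b r s y → (y - r) * ((y - s) * (y - - (r + s))) ≡
                   1ℤ * (y * y * y + a * y + b) + - (y - r) * (r * r + r * s + s * s + a)
                   + - 1ℤ * (r * r * r + a * r + b)
        identity = solve-∀

      -- Modulo p, D = ((r - s)(r - q)(s - q))² for the third root q = - (r + s).
      third-distinct : ¬ (+ p ∣ D) → ¬ (+ p ∣ r - - (r + s))
      third-distinct p∤D r≡q = p∤D (combine₃ r≡q quotient f[r]≡0
          ((r - s) * (r - s) * (+ 2 * r + s) * (r + + 2 * s) * (r + + 2 * s))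
          (- + 4 * (a * a + a * c + c * c) + + 27 * r * (b + r * s * (r + s)))
          (- + 27 * (b + r * s * (r + s))) (identity a b r s))
        where
        -- The cubic with roots r, s, - (r + s) has coefficients `c` and r s (r + s). Replacing a
        -- and b by them changes D by multiples of a - c, the quotient above, and of b - r s (r +
        -- s), which is f r minus r times that quotient.
        c = - (r * r + r * s + s * s)
        identity : ∀ a b r s → let c = - (r * r + r * s + s * s) in
          - (+ 4 * (a * a * a) + + 27 * (b * b)) ≡
          ((r - s) * (r - s) * (+ 2 * r + s) * (r + + 2 * s) * (r + + 2 * s)) * (r - - (r + s))
          + (- + 4 * (a * a + a * c + c * c) + + 27 * r * (b + r * s * (r + s))) * (r * r + r * s + s * s + a)
          + (- + 27 * (b + r * s * (r + s))) * (r * r * r + a * r + b)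
        identity = solve-∀

  -- For β = - 2at + B x - 3t x² these two say that the second and third elementary symmetric functions
  -- of the values of β at the roots of f agree with those of the roots themselves; the first
  -- agrees automatically.
  Q H : ℤ → ℤ → ℤ
  Q B t = a * (B * B) - + 9 * b * B * t - + 3 * (a * a) * (t * t)
  H B t = b * (B * B * B) + + 2 * (a * a) * t * (B * B) - + 9 * (a * b) * B * (t * t)
          + (+ 2 * (a * a * a) + + 27 * (b * b)) * (t * t * t)

  module Permutation {p : ℕ} (prime : Prime p) {B t}
    (Q≡a : + p ∣ Q B t - a) (H≡b : + p ∣ H B t - b) where
    open PrimeDivisibility prime

    fixes : ℤ → Set
    fixes r = + p ∣ - + 2 * a * t + B * r - + 3 * t * (r * r) - r

    -- At t = 0 the two equations become a B² ≡ a and b B³ ≡ b, so B² and B³ are both 1.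
    identity-if : ¬ (+ p ∣ a) → ¬ (+ p ∣ b) → + p ∣ t → + p ∣ B - 1ℤ
    identity-if p∤a p∤b p∣t = combine₂ B³≡1 B²≡1 1ℤ (- B) (identity₃ B)
      where
      identity₁ : ∀ a b B t → a * (B * B - 1ℤ) ≡
        1ℤ * (a * (B * B) - + 9 * b * B * t - + 3 * (a * a) * (t * t) - a) + (+ 9 * b * B + + 3 * (a * a) * t) * t
      identity₁ = solve-∀
      identity₂ : ∀ a b B t → b * (B * B * B - 1ℤ) ≡
        1ℤ * (b * (B * B * B) + + 2 * (a * a) * t * (B * B) - + 9 * (a * b) * B * (t * t)
          + (+ 2 * (a * a * a) + + 27 * (b * b)) * (t * t * t) - b)
        + - (+ 2 * (a * a) * (B * B) - + 9 * (a * b) * B * t + (+ 2 * (a * a * a) + + 27 * (b * b)) * (t * t)) * t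
      identity₂ = solve-∀
      identity₃ : ∀ B → B - 1ℤ ≡ 1ℤ * (B * B * B - 1ℤ) + - B * (B * B - 1ℤ)
      identity₃ = solve-∀
      k = + 2 * (a * a) * (B * B) - + 9 * (a * b) * B * t + (+ 2 * (a * a * a) + + 27 * (b * b)) * (t * t)
      B²≡1 = cancelˡ p∤a (combine₂ Q≡a p∣t 1ℤ (+ 9 * b * B + + 3 * (a * a) * t) (identity₁ a b B t))
      B³≡1 = cancelˡ p∤b (combine₂ H≡b p∣t 1ℤ (- k) (identity₂ a b B t))

    -- A fixed root r forces t (3r² + a) ≡ - r; with D = - (3r² + 4a)(3r² + a)², D t² ≡ a² becomes
    -- (3r² + a)(r² + a) ≡ 0.
    fixedRoot⇒Dt²≢a² : ¬ (+ p ∣ b) → ¬ (+ p ∣ D) → ¬ (+ p ∣ t) → ∀ r → + p ∣ f r → fixes r →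
                       ¬ (+ p ∣ D * (t * t) - a * a)
    fixedRoot⇒Dt²≢a² p∤b p∤D p∤t r f[r]≡0 fixed Dt²≡a² = p∤b p∣b
      where
      m n w : ℤ
      m = + 3 * (r * r) + a
      n = + 3 * (r * r) + + 4 * a
      w = r + + 2 * a * t + + 3 * t * (r * r)

      D≡-nm² : + p ∣ D + n * (m * m)
      D≡-nm² = subst (+ p ∣_) (sym (identity a b r)) (∣n⇒∣m*n (- + 27 * (b - (r * r * r + a * r))) f[r]≡0)
        where
        identity : ∀ a b r → let m = + 3 * (r * r) + a ; n = + 3 * (r * r) + + 4 * a in
          - (+ 4 * (a * a * a) + + 27 * (b * b)) + n * (m * m) ≡
          (- + 27 * (b - (r * r * r + a * r))) * (r * r * r + a * r + b)
        identity = solve-∀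

      p∤m : ¬ (+ p ∣ m)
      p∤m p∣m = p∤D (combine₂ D≡-nm² p∣m 1ℤ (- (n * m)) (identity D n m))
        where
        identity : ∀ D n m → D ≡ 1ℤ * (D + n * (m * m)) + - (n * m) * m
        identity = solve-∀

      p∤n : ¬ (+ p ∣ n)
      p∤n p∣n = p∤D (combine₂ D≡-nm² p∣n 1ℤ (- (m * m)) (identity D n m))
        where
        identity : ∀ D n m → D ≡ 1ℤ * (D + n * (m * m)) + - (m * m) * n
        identity = solve-∀

      -- Fixedness reads B r ≡ w. Substituting this into r² (Q - a), and b ≡ - r³ - a r from f,
      -- leaves the product t m n (r + t m).
      r+tm≡0 : + p ∣ r + t * m
      r+tm≡0 = cancelˡ p∤n (cancelˡ p∤m (cancelˡ p∤t
        (combine₃ Q≡a fixed f[r]≡0 (r * r) (- (a * (B * r + w) - + 9 * b * r * t))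
          (+ 9 * r * t * w)
          (identity a b B t r))))
        where
        identity : ∀ a b B t r →
          let m = + 3 * (r * r) + a
              n = + 3 * (r * r) + + 4 * a
              w = r + + 2 * a * t + + 3 * t * (r * r)
          in t * (m * (n * (r + t * m))) ≡
             (r * r) * (a * (B * B) - + 9 * b * B * t - + 3 * (a * a) * (t * t) - a)
             + (- (a * (B * r + w) - + 9 * b * r * t)) * (- + 2 * a * t + B * r - + 3 * t * (r * r) - r)
             + + 9 * r * t * w * (r * r * r + a * r + b)
        identity = solve-∀

      r²+a≡0 : + p ∣ r * r + a
      r²+a≡0 = cancelˡ p∤m (combine₃ Dt²≡a² D≡-nm² r+tm≡0 (- 1ℤ) (t * t) (n * (r - t * m))
        (identity a D t r))
        where
        identity : ∀ a D t r →
          let m = + 3 * (r * r) + a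
              n = + 3 * (r * r) + + 4 * a
          in m * (r * r + a) ≡ - 1ℤ * (D * (t * t) - a * a) + t * t * (D + n * (m * m)) + n * (r - t * m) * (r + t * m)
        identity = solve-∀

      -- With r² ≡ - a the value f r collapses to its constant term.
      p∣b : + p ∣ b
      p∣b = combine₂ f[r]≡0 r²+a≡0 1ℤ (- r) (identity a b r)
        where
        identity : ∀ a b r → b ≡ 1ℤ * (r * r * r + a * r + b) + - r * (r * r + a)
        identity = solve-∀

    -- Eliminating the inhomogeneous terms from Q ≡ a and H ≡ b gives b² Q³ ≡ a³ H², a binary sextic in B and t
    -- with the factor a³t³ + a²tB² + bB³, which vanishes iff at/B is a root of f.
    root-if : ¬ (+ p ∣ a) → ¬ (+ p ∣ D) → ¬ (+ p ∣ t) → ¬ (+ p ∣ D * (t * t) - a * a) →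
              ∃[ r ] (+ p ∣ f r)
    root-if p∤a p∤D p∤t Dt²≢a² = r , cancelˡ p∤B (cancelˡ p∤B (cancelˡ p∤B
        (combine₂ G≡0 (proj₂ B⁻¹) 1ℤ (g * (+ 3 + + 3 * e + e * e) + a * a * t * (B * B))
          (identity a b B t B′))))
      where
      q h G : ℤ
      q = Q B t
      h = H B t
      G = a * a * a * (t * t * t) + a * a * t * (B * B) + b * (B * B * B)

      -- Besides `G`, the sextic has the factors t, the constant D and this quadratic form, which is
      -- D t² - a² because Q ≡ a.
      Dt²-aQ≢0 : ¬ (+ p ∣ D * (t * t) - a * Q B t)
      Dt²-aQ≢0 p∣ = Dt²≢a² (combine₂ p∣ Q≡a 1ℤ a (identity a (D * (t * t)) (Q B t)))
        where
        identity : ∀ a d q → d - a * a ≡ 1ℤ * (d - a * q) + a * (q - a)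
        identity = solve-∀

      elimination : ∀ a b B t →
        let D = - (+ 4 * (a * a * a) + + 27 * (b * b))
            Q = a * (B * B) - + 9 * b * B * t - + 3 * (a * a) * (t * t)
            H = b * (B * B * B) + + 2 * (a * a) * t * (B * B) - + 9 * (a * b) * B * (t * t)
                + (+ 2 * (a * a * a) + + 27 * (b * b)) * (t * t * t)
            G = a * a * a * (t * t * t) + a * a * t * (B * B) + b * (B * B * B)
        in t * (D * ((D * (t * t) - a * Q) * G)) ≡
           (a * a * a * (H + b)) * (H - b) + (- (b * b * (Q * Q + Q * a + a * a))) * (Q - a)
      elimination = solve-∀

      G≡0 : + p ∣ G
      G≡0 = cancelˡ Dt²-aQ≢0 (cancelˡ p∤D (cancelˡ p∤t
        (combine₂ H≡b Q≡a (a * a * a * (h + b)) (- (b * b * (q * q + q * a + a * a))) (elimination a b B t))))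

      p∤B : ¬ (+ p ∣ B)
      p∤B p∣B = p∤t (square (cancelˡ p∤t (cancelˡ p∤a (cancelˡ p∤a (cancelˡ p∤a
        (combine₂ G≡0 p∣B 1ℤ (- (a * a * t * B + b * (B * B))) (identity a b B t)))))))
        where
        identity : ∀ a b B t → a * (a * (a * (t * (t * t)))) ≡
          1ℤ * (a * a * a * (t * t * t) + a * a * t * (B * B) + b * (B * B * B))
          + (- (a * a * t * B + b * (B * B))) * B
        identity = solve-∀

      B⁻¹ = inverse B p∤B
      B′ = proj₁ B⁻¹
      r = a * t * B′
      -- The error of the inverse: B B′ = 1 + e, and (1 + e)³ - 1 = e (3 + 3 e + e²) supplies the
      -- multiplier of e.
      e = B * B′ - 1ℤ
      g = a * a * a * (t * t * t)

      identity : ∀ a b B t B′ → let r = a * t * B′ ; e = B * B′ - 1ℤ in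
        B * (B * (B * (r * r * r + a * r + b))) ≡
        1ℤ * (a * a * a * (t * t * t) + a * a * t * (B * B) + b * (B * B * B))
        + (a * a * a * (t * t * t) * (+ 3 + + 3 * e + e * e) + a * a * t * (B * B)) * e
      identity = solve-∀

    -- The divided difference of β - x at two of its zeros.
    slope : ∀ r s → ¬ (+ p ∣ r - s) → fixes r → fixes s → + p ∣ B - 1ℤ - + 3 * t * (r + s)
    slope r s r≢s fixed-r fixed-s = cancelˡ r≢s (combine₂ fixed-r fixed-s 1ℤ (- 1ℤ) (identity a B t r s))
      where
      identity : ∀ a B t r s → (r - s) * (B - 1ℤ - + 3 * t * (r + s)) ≡
        1ℤ * (- + 2 * a * t + B * r - + 3 * t * (r * r) - r)
        + - 1ℤ * (- + 2 * a * t + B * s - + 3 * t * (s * s) - s)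
      identity = solve-∀

    -- Two fixed roots give a third one, but β - x is quadratic with leading coefficient - 3t.
    atMostOneFixedRoot : ¬ (+ p ∣ + 3) → ¬ (+ p ∣ D) → ¬ (+ p ∣ t) → (∀ r → + p ∣ f r → fixes r) →
                         ∀ r s → + p ∣ f r → + p ∣ f s → + p ∣ r - s
    atMostOneFixedRoot p∤3 p∤D p∤t fixed r s f[r]≡0 f[s]≡0 with + p ∣? r - s
    ... | yes r≡s = r≡s
    ... | no  r≢s = contradiction
        (cancelˡ p∤t (cancelˡ p∤3 (combine₂
          (slope r q (third-distinct p∤D) (fixed r f[r]≡0) (fixed q third))
          (slope r s r≢s (fixed r f[r]≡0) (fixed s f[s]≡0))
          1ℤ (- 1ℤ) (identity B t r s))))
        (Pair.third-distinct s r f[s]≡0 f[r]≡0 (λ s≡r → r≢s (∣-swap s r s≡r)) p∤D)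
      where
      open Roots prime
      open Pair r s f[r]≡0 f[s]≡0 r≢s
      q = - (r + s)

      identity : ∀ B t r s → + 3 * (t * (s - - (s + r))) ≡
        1ℤ * (B - 1ℤ - + 3 * t * (r + - (r + s))) + - 1ℤ * (B - 1ℤ - + 3 * t * (r + s))
      identity = solve-∀

-- The Frobenius image of the generator

module FrobeniusImage {p : ℕ} (prime : Prime p) (a b : ℤ) where

  open DepressedCubic a b
  open PrimeDivisibility prime

  module K = CommutativeRing (Residues.commutativeRing p)
  module KExp = Exp K.semiring
  module KMult = Mult K.semiring
  module R = CommutativeRing (CubicResidues.commutativeRing p a b)
  module RExp = Exp R.semiring
  module RMult = Mult R.semiring

  open Residues p using (congruent; difference; ≡⇒≈)
  open CubicResidues p a b using (pointwise; norm-cong)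

  ∣⇒≈0 : ∀ {x} → + p ∣ x → x K.≈ 0ℤ
  ∣⇒≈0 {x} p∣x = congruent (subst (+ p ∣_) (sym (ℤ.+-identityʳ x)) p∣x)

  ≈0⇒∣ : ∀ {x} → x K.≈ 0ℤ → + p ∣ x
  ≈0⇒∣ {x} (congruent p∣x) = subst (+ p ∣_) (ℤ.+-identityʳ x) p∣x

  n×1≡n : ∀ n → n KMult.× 1ℤ ≡ + n
  n×1≡n zero    = refl
  n×1≡n (suc n) = cong (λ z → 1ℤ + z) (n×1≡n n)

  n×1≡[n,0,0] : ∀ n → n RMult.× R.1# ≡ (+ n , 0ℤ , 0ℤ)
  n×1≡[n,0,0] zero    = refl
  n×1≡[n,0,0] (suc n) = cong (plus R.1#) (n×1≡[n,0,0] n)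

  private
    p≈0 : + p K.≈ 0ℤ
    p≈0 = ∣⇒≈0 ∣-refl
    module CharK = Characteristic (Residues.commutativeRing p) prime
                     (K.trans (≡⇒≈ (n×1≡n p)) p≈0)
    module CharR = Characteristic (CubicResidues.commutativeRing p a b) prime
                     (R.trans (R.reflexive (n×1≡[n,0,0] p)) (pointwise (p≈0 , K.refl , K.refl)))

  p∤1 : ¬ (+ p ∣ 1ℤ)
  p∤1 p∣1 = contradiction (ℕ.∣1⇒≡1 (∣⇒∣ᵤ p∣1)) (ℕ.nonTrivial⇒≢1 {{prime⇒nonTrivial prime}})

  fermat : ∀ k → k KExp.^ p K.≈ k
  fermat k with reduce k
  ... | r , _ , p∣k-r = begin
    k KExp.^ p                     ≈⟨ KExp.^-congˡ p k≈r ⟩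
    (r KMult.× 1ℤ) KExp.^ p        ≈⟨ CharK.fermat r ⟩
    r KMult.× 1ℤ                   ≈⟨ k≈r ⟨
    k                              ∎
    where
    open import Relation.Binary.Reasoning.Setoid K.setoid
    k≈r : k K.≈ r KMult.× 1ℤ
    k≈r = K.trans (congruent p∣k-r) (≡⇒≈ (sym (n×1≡n r)))

  -- Powers of the generator and the recurrence

  X : R.Carrier
  X = 0ℤ , 1ℤ , 0ℤ

  X*≡ : ∀ x y z → X R.* (x , y , z) ≡ (- (b * z) , x - a * z , y)
  X*≡ x y z = cong₂ _,_ (identity₀ b x y z) (cong₂ _,_ (identity₁ a b x y z) (identity₂ a x y z))
    where
    identity₀ : ∀ b x y z → 0ℤ * x - b * (1ℤ * z + 0ℤ * y) ≡ - (b * z)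
    identity₀ = solve-∀
    identity₁ : ∀ a b x y z → 0ℤ * y + 1ℤ * x - a * (1ℤ * z + 0ℤ * y) - b * (0ℤ * z) ≡ x - a * z
    identity₁ = solve-∀
    identity₂ : ∀ a x y z → 0ℤ * z + 1ℤ * y + 0ℤ * x - a * (0ℤ * z) ≡ y
    identity₂ = solve-∀

  -- The coefficient of x in X · r, which is the functional that reads off u.
  linearPart : R.Carrier → ℤ
  linearPart (x , y , z) = x - a * z

  -- x³ = - a x - b makes every linear functional of the powers of x satisfy the recurrence, and on
  -- x, x², x³ this one takes the values 0, - a, - b. The exponent is one ahead of the index, so
  -- index p - 1 reads off x ^ p.
  u≡linearPart : ∀ (u : ℕ → ℤ) → u 0 ≡ 0ℤ → u 1 ≡ - a → u 2 ≡ - b →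
    (∀ n → u (n ℕ.+ 3) + a * u (n ℕ.+ 1) + b * u n ≡ 0ℤ) →
    ∀ n → u n ≡ linearPart (X RExp.^ suc n)
  u≡linearPart u u₀ u₁ u₂ u-recurrence n = proj₁ (agree n)
    where
    v : ℕ → ℤ
    v n = linearPart (X RExp.^ suc n)

    linearPart-X* : ∀ x y z → linearPart (X R.* (x , y , z)) ≡ - (b * z) - a * y
    linearPart-X* x y z = cong linearPart (X*≡ x y z)

    linearPart-X*X* : ∀ x y z → linearPart (X R.* (X R.* (x , y , z))) ≡ - (b * y) - a * (x - a * z)
    linearPart-X*X* x y z = trans (cong (λ w → linearPart (X R.* w)) (X*≡ x y z)) (linearPart-X* (- (b * z)) (x - a * z) y)

    v-recurrence : ∀ w → linearPart (X R.* (X R.* (X R.* w))) + a * linearPart (X R.* w) + b * linearPart w ≡ 0ℤ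
    v-recurrence (x , y , z) = trans
      (cong₂ (λ l m → l + a * m + b * (x - a * z))
        (trans (cong (λ w → linearPart (X R.* (X R.* w))) (X*≡ x y z)) (linearPart-X*X* (- (b * z)) (x - a * z) y))
        (linearPart-X* x y z))
      (identity a b x y z)
      where
      identity : ∀ a b x y z →
        - (b * (x - a * z)) - a * (- (b * z) - a * y) + a * (- (b * z) - a * y) + b * (x - a * z) ≡ 0ℤ
      identity = solve-∀

    determined : ∀ x y z z′ → z + a * y + b * x ≡ 0ℤ → z′ + a * y + b * x ≡ 0ℤ → z ≡ z′
    determined x y z z′ eq eq′ =
      +-cancelʳ (a * y) z z′ (+-cancelʳ (b * x) (z + a * y) (z′ + a * y) (trans eq (sym eq′)))

    agree : ∀ n → u n ≡ v n × u (1 ℕ.+ n) ≡ v (1 ℕ.+ n) × u (2 ℕ.+ n) ≡ v (2 ℕ.+ n)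
    agree zero =
      trans u₀ (sym (trans (cong linearPart (X*≡ 1ℤ 0ℤ 0ℤ)) (identity₀ a b))) ,
      trans u₁ (sym (trans (linearPart-X*X* 1ℤ 0ℤ 0ℤ) (identity₁ a b))) ,
      trans u₂ (sym (trans (cong (λ w → linearPart (X R.* (X R.* w))) (X*≡ 1ℤ 0ℤ 0ℤ))
                           (trans (linearPart-X*X* (- (b * 0ℤ)) (1ℤ - a * 0ℤ) 0ℤ) (identity₂ a b))))
      where
      identity₀ : ∀ a b → - (b * 0ℤ) - a * 0ℤ ≡ 0ℤ
      identity₀ = solve-∀
      identity₁ : ∀ a b → - (b * 0ℤ) - a * (1ℤ - a * 0ℤ) ≡ - a
      identity₁ = solve-∀
      identity₂ : ∀ a b → - (b * (1ℤ - a * 0ℤ)) - a * (- (b * 0ℤ) - a * 0ℤ) ≡ - b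
      identity₂ = solve-∀
    agree (suc n) with agree n
    ... | e₀ , e₁ , e₂ = e₁ , e₂ , determined (v n) (v (1 ℕ.+ n)) (u (3 ℕ.+ n)) (v (3 ℕ.+ n))
                              (subst₂ (λ y x → u (3 ℕ.+ n) + a * y + b * x ≡ 0ℤ) e₁ e₀ recurrence)
                              (v-recurrence (X RExp.^ suc n))
      where
      recurrence : u (3 ℕ.+ n) + a * u (1 ℕ.+ n) + b * u n ≡ 0ℤ
      recurrence = subst (λ k → u (3 ℕ.+ n) + a * u k + b * u n ≡ 0ℤ) (ℕ.+-comm n 1)
        (subst (λ k → u k + a * u (n ℕ.+ 1) + b * u n ≡ 0ℤ) (ℕ.+-comm n 3) (u-recurrence n))

  [X+c]^p≈X^p+c : ∀ c → (+ c , 1ℤ , 0ℤ) RExp.^ p R.≈ X RExp.^ p R.+ (+ c , 0ℤ , 0ℤ)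
  [X+c]^p≈X^p+c c = begin
    (X R.+ (+ c , 0ℤ , 0ℤ)) RExp.^ p                  ≡⟨ cong (λ k → (X R.+ k) RExp.^ p) (n×1≡[n,0,0] c) ⟨
    (X R.+ c RMult.× R.1#) RExp.^ p                   ≈⟨ CharR.frobenius X (c RMult.× R.1#) ⟩
    X RExp.^ p R.+ (c RMult.× R.1#) RExp.^ p          ≈⟨ R.+-congˡ {X RExp.^ p} (CharR.fermat c) ⟩
    X RExp.^ p R.+ c RMult.× R.1#                     ≡⟨ cong (X RExp.^ p R.+_) (n×1≡[n,0,0] c) ⟩
    X RExp.^ p R.+ (+ c , 0ℤ , 0ℤ)                    ∎
    where open import Relation.Binary.Reasoning.Setoid R.setoid

  norm-linear^ : ∀ c n → norm id a b ((c , 1ℤ , 0ℤ) RExp.^ n) ≡ norm id a b (c , 1ℤ , 0ℤ) KExp.^ n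
  norm-linear^ c zero    = identity a b
    where
    identity : ∀ a b →
      1ℤ * 1ℤ * 1ℤ - b * (0ℤ * 0ℤ * 0ℤ) + b * b * (0ℤ * 0ℤ * 0ℤ)
      - + 2 * a * (1ℤ * 1ℤ * 0ℤ) + a * (1ℤ * 0ℤ * 0ℤ) + a * a * (1ℤ * 0ℤ * 0ℤ)
      - a * b * (0ℤ * 0ℤ * 0ℤ) + + 3 * b * (1ℤ * 0ℤ * 0ℤ) ≡ 1ℤ
    identity = solve-∀
  norm-linear^ c (suc n) = trans
    (norm-times-linear a b c ((c , 1ℤ , 0ℤ) RExp.^ n))
    (cong (norm id a b (c , 1ℤ , 0ℤ) *_) (norm-linear^ c n))

  -- The norm of (x + c) ^ p is the p-th power of an element of 𝔽ₚ, so Fermat removes the exponent.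
  norm-shift : ∀ {y} → X RExp.^ p R.≈ y → ∀ c →
               norm id a b (y R.+ (+ c , 0ℤ , 0ℤ)) K.≈ norm id a b (+ c , 1ℤ , 0ℤ)
  norm-shift {y} X^p≈y c = begin
    norm id a b (y R.+ (+ c , 0ℤ , 0ℤ))           ≈⟨ norm-cong (R.+-congʳ X^p≈y) ⟨
    norm id a b (X RExp.^ p R.+ (+ c , 0ℤ , 0ℤ))  ≈⟨ norm-cong ([X+c]^p≈X^p+c c) ⟨
    norm id a b ((+ c , 1ℤ , 0ℤ) RExp.^ p)        ≡⟨ norm-linear^ (+ c) p ⟩
    norm id a b (+ c , 1ℤ , 0ℤ) KExp.^ p          ≈⟨ fermat _ ⟩
    norm id a b (+ c , 1ℤ , 0ℤ)                   ∎
    where open import Relation.Binary.Reasoning.Setoid K.setoid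

  -- Evaluation at roots and regularity of x - i

  evaluate : R.Carrier → ℤ → ℤ
  evaluate (x , y , z) r = x + y * r + z * (r * r)

  evaluate-cong : ∀ {v w} r → v R.≈ w → evaluate v r K.≈ evaluate w r
  evaluate-cong r (pointwise (x≈x′ , y≈y′ , z≈z′)) =
    K.+-cong (K.+-cong x≈x′ (K.*-congʳ {r} y≈y′)) (K.*-congʳ {r * r} z≈z′)

  -- Reducing x · v subtracts a multiple of f, which vanishes at r; evaluation at r is therefore
  -- compatible with multiplication by x.
  evaluate-X^ : ∀ r → + p ∣ f r → ∀ n → evaluate (X RExp.^ n) r K.≈ r KExp.^ n
  evaluate-X^ r f[r]≡0 zero    = ≡⇒≈ (identity r)
    where
    identity : ∀ r → 1ℤ + 0ℤ * r + 0ℤ * (r * r) ≡ 1ℤ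
    identity = solve-∀
  evaluate-X^ r f[r]≡0 (suc n) = K.trans
    (congruent (subst (+ p ∣_) (sym (eq (X RExp.^ n))) (∣n⇒∣m*n (- proj₂ (proj₂ (X RExp.^ n))) f[r]≡0)))
    (K.*-congˡ {r} (evaluate-X^ r f[r]≡0 n))
    where
    identity : ∀ a b r x y z → (- (b * z) + (x - a * z) * r + y * (r * r)) - r * (x + y * r + z * (r * r))
               ≡ (- z) * (r * r * r + a * r + b)
    identity = solve-∀
    eq : ∀ v → evaluate (X R.* v) r - r * evaluate v r ≡ (- proj₂ (proj₂ v)) * f r
    eq (x , y , z) = trans (cong (λ w → evaluate w r - r * (x + y * r + z * (r * r))) (X*≡ x y z)) (identity a b r x y z)

  evaluate-X^p : ∀ r → + p ∣ f r → evaluate (X RExp.^ p) r K.≈ r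
  evaluate-X^p r f[r]≡0 = K.trans (evaluate-X^ r f[r]≡0 p) (fermat r)

  linear-cancel : ∀ i → ¬ (+ p ∣ f (+ i)) → ∀ v → (X R.- i RMult.× R.1#) R.* v R.≈ R.0# → v R.≈ R.0#
  linear-cancel i f[i]≢0 (x , y , z) eq rewrite n×1≡[n,0,0] i with eq
  ... | pointwise (e₀ , e₁ , e₂) = pointwise (∣⇒≈0 p∣x , ∣⇒≈0 p∣y , ∣⇒≈0 p∣z)
    where
    k = + i
    p∣z : + p ∣ z
    -- The reduced product is (x - k) v - z f; evaluated at x = k, with weights 1, k, k² on its
    -- coordinates, it gives - z f k.
    p∣z = cancelˡ f[i]≢0 (combine₃ (≈0⇒∣ e₀) (≈0⇒∣ e₁) (≈0⇒∣ e₂) (- 1ℤ) (- k) (- (k * k)) (identity a b k x y z))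
      where
      identity : ∀ a b k x y z → (k * k * k + a * k + b) * z ≡
        - 1ℤ * ((0ℤ + - k) * x - b * ((1ℤ + - 0ℤ) * z + (0ℤ + - 0ℤ) * y))
        + - k * ((0ℤ + - k) * y + (1ℤ + - 0ℤ) * x - a * ((1ℤ + - 0ℤ) * z + (0ℤ + - 0ℤ) * y) - b * ((0ℤ + - 0ℤ) * z))
        + - (k * k) * ((0ℤ + - k) * z + (1ℤ + - 0ℤ) * y + (0ℤ + - 0ℤ) * x - a * ((0ℤ + - 0ℤ) * z))
      identity = solve-∀
    p∣y : + p ∣ y
    p∣y = combine₂ (≈0⇒∣ e₂) p∣z 1ℤ k (identity a k x y z)
      where
      identity : ∀ a k x y z → y ≡
        1ℤ * ((0ℤ + - k) * z + (1ℤ + - 0ℤ) * y + (0ℤ + - 0ℤ) * x - a * ((0ℤ + - 0ℤ) * z)) + k * z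
      identity = solve-∀
    p∣x : + p ∣ x
    p∣x = combine₃ (≈0⇒∣ e₁) p∣y p∣z 1ℤ k a (identity a b k x y z)
      where
      identity : ∀ a b k x y z → x ≡
        1ℤ * ((0ℤ + - k) * y + (1ℤ + - 0ℤ) * x - a * ((1ℤ + - 0ℤ) * z + (0ℤ + - 0ℤ) * y) - b * ((0ℤ + - 0ℤ) * z))
        + k * y + a * z
      identity = solve-∀

  X^p≈X⇒twoRoots : X RExp.^ p R.≈ X →
    ∃[ r ] ∃[ s ] (r ℕ.< p × s ℕ.< p × ¬ (r ≡ s) × + p ∣ f (+ r) × + p ∣ f (+ s))
  X^p≈X⇒twoRoots = twoRoots (λ (pointwise (1≈0 , _)) → p∤1 (≈0⇒∣ 1≈0)) factor≉0
    where
    open CharR.ZeroDivisors X (λ j → + p ∣? f (+ j)) (λ {j} f[j]≢0 {y} → linear-cancel j f[j]≢0 y)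
    factor≉0 : ∀ j → ¬ (X R.- j RMult.× R.1# R.≈ R.0#)
    factor≉0 j rewrite n×1≡[n,0,0] j = λ (pointwise (_ , 1≈0 , _)) → p∤1 (≈0⇒∣ 1≈0)

  -- The first two elementary symmetric functions of the values of the triple at the roots of f;
  -- they are the coefficients of c² and c in the norm of v + c.
  trace secondSymmetric : R.Carrier → ℤ
  trace (x , y , z) = + 3 * x - + 2 * a * z
  secondSymmetric (x , y , z) = + 3 * (x * x) - + 4 * a * (x * z) + a * (y * y) + a * a * (z * z) + + 3 * b * (y * z)

  norm-+ : ∀ v c → norm id a b (v R.+ (c , 0ℤ , 0ℤ)) ≡
                   c * c * c + c * c * trace v + c * secondSymmetric v + norm id a b v
  norm-+ (x , y , z) c = solve 6 (λ a b c x y z →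
    norm′ con a b (x :+ c , y :+ con 0ℤ , z :+ con 0ℤ) :=
    c :* c :* c :+ c :* c :* (con (+ 3) :* x :- con (+ 2) :* a :* z)
    :+ c :* (con (+ 3) :* (x :* x) :- con (+ 4) :* a :* (x :* z) :+ a :* (y :* y) :+ a :* a :* (z :* z)
           :+ con (+ 3) :* b :* (y :* z))
    :+ norm′ con a b (x , y , z)) refl a b c x y z
    where
    open +-*-Solver using (Polynomial; solve; con; _:+_; _:-_; _:*_; _:=_)
    norm′ = Symbolic.norm {6}

  norm-linear : ∀ c → norm id a b (c , 1ℤ , 0ℤ) ≡ c * c * c + a * c - b
  norm-linear c = solve 3 (λ a b c → Symbolic.norm con a b (c , con 1ℤ , con 0ℤ) := c :* c :* c :+ a :* c :- b) refl a b c
    where open +-*-Solver using (solve; con; _:+_; _:-_; _:*_; _:=_)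

  module Image {v} (X^p≈v : X RExp.^ p R.≈ v) (p∤2 : ¬ (+ p ∣ + 2)) where

    private
      T E n : ℤ
      T = trace v
      E = secondSymmetric v
      n = norm id a b v

      -- The cubes cancel, leaving a quadratic in c that vanishes for every c. Its second difference
      -- at 0, 1, 2 is `+ 2 * T`, whence the condition on 2; the other coefficients then follow from
      -- the values at 0 and 1.
      shifted-norm : ∀ c → let k = + c in + p ∣ k * k * T + k * (E - a) + (n + b)
      shifted-norm c = subst (+ p ∣_)
        (trans (cong₂ _-_ (norm-+ v (+ c)) (norm-linear (+ c))) (identity (+ c) T E n a b))
        (difference (norm-shift X^p≈v c))
        where
        identity : ∀ k T E n a b →
          k * k * k + k * k * T + k * E + n - (k * k * k + a * k - b) ≡ k * k * T + k * (E - a) + (n + b)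
        identity = solve-∀

    norm≡ : + p ∣ n + b
    norm≡ = subst (+ p ∣_) (identity T (E - a) (n + b)) (shifted-norm 0)
      where
      identity : ∀ T E n → 0ℤ * 0ℤ * T + 0ℤ * E + n ≡ n
      identity = solve-∀

    trace≡ : + p ∣ T
    trace≡ = cancelˡ p∤2 (combine₃ (shifted-norm 2) (shifted-norm 1) (shifted-norm 0) 1ℤ (- + 2) 1ℤ
      (identity T (E - a) (n + b)))
      where
      identity : ∀ T E n → + 2 * T ≡ 1ℤ * (+ 2 * + 2 * T + + 2 * E + n) + - + 2 * (1ℤ * 1ℤ * T + 1ℤ * E + n)
        + 1ℤ * (0ℤ * 0ℤ * T + 0ℤ * E + n)
      identity = solve-∀

    second≡ : + p ∣ E - a
    second≡ = combine₃ (shifted-norm 1) trace≡ norm≡ 1ℤ (- 1ℤ) (- 1ℤ) (identity T (E - a) (n + b))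
      where
      identity : ∀ T E n → E ≡ 1ℤ * (1ℤ * 1ℤ * T + 1ℤ * E + n) + - 1ℤ * T + - 1ℤ * n
      identity = solve-∀

  -- Vanishing of the trace leaves one parameter t in the coefficients of 1 and x².
  normalForm : ∀ v → + p ∣ trace v → ¬ (+ p ∣ a) →
    ∃[ t ] (v R.≈ (- + 2 * a * t , proj₁ (proj₂ v) , - + 3 * t) × + p ∣ a * t - linearPart v)
  normalForm (x , y , z) p∣trace p∤a = t , pointwise (congruent x≡ , K.refl , congruent z≡) , at≡u
    where
    u = x - a * z
    a⁻¹ = inverse a p∤a
    t = proj₁ a⁻¹ * u
    at≡u : + p ∣ a * t - u
    at≡u = subst (+ p ∣_) (identity a (proj₁ a⁻¹) u) (∣n⇒∣m*n u (proj₂ a⁻¹))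
      where
      identity : ∀ a a′ u → u * (a * a′ - 1ℤ) ≡ a * (a′ * u) - u
      identity = solve-∀
    x≡ : + p ∣ x - - + 2 * a * t
    x≡ = combine₂ p∣trace at≡u 1ℤ (+ 2) (identity a t x z)
      where
      identity : ∀ a t x z → x - - + 2 * a * t ≡ 1ℤ * (+ 3 * x - + 2 * a * z) + + 2 * (a * t - (x - a * z))
      identity = solve-∀
    z≡ : + p ∣ z - - + 3 * t
    z≡ = cancelˡ p∤a (combine₂ p∣trace at≡u 1ℤ (+ 3) (identity a t x z))
      where
      identity : ∀ a t x z → a * (z - - + 3 * t) ≡ 1ℤ * (+ 3 * x - + 2 * a * z) + + 3 * (a * t - (x - a * z))
      identity = solve-∀

  reducedImage : ¬ (+ p ∣ + 2) → ¬ (+ p ∣ a) →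
    ∃[ B ] ∃[ t ] (X RExp.^ p R.≈ (- + 2 * a * t , B , - + 3 * t) × + p ∣ a * t - linearPart (X RExp.^ p))
  reducedImage p∤2 p∤a =
    let t , X^p≈v , at≡u = normalForm (X RExp.^ p) (Image.trace≡ R.refl p∤2) p∤a
    in proj₁ (proj₂ (X RExp.^ p)) , t , X^p≈v , at≡u

  module Reduced {B t} (X^p≈β : X RExp.^ p R.≈ (- + 2 * a * t , B , - + 3 * t)) where

    Q≡a : ¬ (+ p ∣ + 2) → + p ∣ Q B t - a
    Q≡a p∤2 = subst (λ e → + p ∣ e - a) (identity a b B t) (Image.second≡ X^p≈β p∤2)
      where
      identity : ∀ a b B t → let x = - + 2 * a * t ; z = - + 3 * t in
        + 3 * (x * x) - + 4 * a * (x * z) + a * (B * B) + a * a * (z * z) + + 3 * b * (B * z) ≡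
        a * (B * B) - + 9 * b * B * t - + 3 * (a * a) * (t * t)
      identity = solve-∀

    H≡b : ¬ (+ p ∣ + 2) → + p ∣ H B t - b
    H≡b p∤2 = subst (+ p ∣_) (identity a b B t) (∣m⇒∣-m (Image.norm≡ X^p≈β p∤2))
      where
      identity : ∀ a b B t → let x = - + 2 * a * t ; z = - + 3 * t in
        - (x * x * x - b * (B * B * B) + b * b * (z * z * z)
           - + 2 * a * (x * x * z) + a * (x * B * B) + a * a * (x * z * z)
           - a * b * (B * z * z) + + 3 * b * (x * B * z) + b) ≡
        b * (B * B * B) + + 2 * (a * a) * t * (B * B) - + 9 * (a * b) * B * (t * t)
          + (+ 2 * (a * a * a) + + 27 * (b * b)) * (t * t * t) - b
      identity = solve-∀

    fixesRoots : ∀ r → + p ∣ f r → + p ∣ - + 2 * a * t + B * r - + 3 * t * (r * r) - r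
    fixesRoots r f[r]≡0 = subst (+ p ∣_) (identity a B t r) (difference (K.trans (K.sym evaluate-≈) (evaluate-X^p r f[r]≡0)))
      where
      evaluate-≈ : evaluate (X RExp.^ p) r K.≈ evaluate (- + 2 * a * t , B , - + 3 * t) r
      evaluate-≈ = evaluate-cong {X RExp.^ p} r X^p≈β
      identity : ∀ a B t r → - + 2 * a * t + B * r + - + 3 * t * (r * r) - r ≡ - + 2 * a * t + B * r - + 3 * t * (r * r) - r
      identity = solve-∀

    X^p≈X : + p ∣ t → + p ∣ B - 1ℤ → X RExp.^ p R.≈ X
    X^p≈X p∣t B≡1 = R.trans {X RExp.^ p} X^p≈β
      (pointwise (∣⇒≈0 (∣n⇒∣m*n (- + 2 * a) p∣t) , congruent B≡1 , ∣⇒≈0 (∣n⇒∣m*n (- + 3) p∣t)))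

-- Counting the roots

module RootCount {p : ℕ} (prime : Prime p) (a b : ℤ) where

  open import Data.List using ([]; _∷_)
  open import Data.List.Relation.Unary.All using ([]; _∷_)
  open import Data.List.Relation.Unary.AllPairs using ([]; _∷_)
  open DepressedCubic a b
  open PrimeDivisibility prime
  open FrobeniusImage prime a b

  polynomial : Poly 3
  polynomial = 1ℤ ∷ 0ℤ ∷ a ∷ b ∷ []

  eval≡f : ∀ x → eval polynomial x ≡ f x
  eval≡f x = identity a b x
    where
    identity : ∀ a b x → 1ℤ * (x * (x * (x * 1ℤ))) + (0ℤ * (x * (x * 1ℤ)) + (a * (x * 1ℤ) + (b * 1ℤ + 0ℤ))) ≡
               x * x * x + a * x + b
    identity = solve-∀

  f-cong : ∀ r s → + p ∣ r - s → + p ∣ f r → + p ∣ f s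
  f-cong r s r≡s f[r]≡0 = combine₂ f[r]≡0 r≡s 1ℤ (- (r * r + r * s + s * s + a)) (identity a b r s)
    where
    identity : ∀ a b r s → s * s * s + a * s + b ≡
      1ℤ * (r * r * r + a * r + b) + - (r * r + r * s + s * s + a) * (r - s)
    identity = solve-∀

  noRoot⇒N≡0 : (∀ r → ¬ (+ p ∣ f r)) → N p polynomial ≡ 0
  noRoot⇒N≡0 noRoot = N≡length p polynomial {[]} [] (λ {r} → mk⇔
    (λ (_ , f[r]≡0) → contradiction (subst (+ p ∣_) (eval≡f (+ r)) f[r]≡0) (noRoot (+ r)))
    (λ ()))

  uniqueRoot⇒N≡1 : ∀ r → + p ∣ f r → (∀ s → + p ∣ f s → + p ∣ r - s) → N p polynomial ≡ 1
  uniqueRoot⇒N≡1 r f[r]≡0 unique with reduce r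
  ... | r′ , r′<p , r≡r′ = N≡length p polynomial {r′ ∷ []} ([] ∷ []) (λ {s} → mk⇔
    (λ (s<p , f[s]≡0) → here (residue-unique s<p r′<p
      (∣-swap (+ r′) (+ s) (combine₂ (unique (+ s) (subst (+ p ∣_) (eval≡f (+ s)) f[s]≡0)) r≡r′ 1ℤ (- 1ℤ)
        (identity r (+ r′) (+ s))))))
    λ where (here refl) → r′<p , subst (+ p ∣_) (sym (eval≡f (+ r′))) (f-cong r (+ r′) r≡r′ f[r]≡0))
    where
    identity : ∀ r r′ s → r′ - s ≡ 1ℤ * (r - s) + - 1ℤ * (r - r′)
    identity = solve-∀

  -- The third root - (r + s) lies in 𝔽ₚ too, and the nonzero discriminant separates it from the
  -- other two.
  twoRoots⇒N≡3 : ¬ (+ p ∣ D) → ∀ r s → r ℕ.< p → s ℕ.< p → ¬ (r ≡ s) →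
                 + p ∣ f (+ r) → + p ∣ f (+ s) → N p polynomial ≡ 3
  twoRoots⇒N≡3 p∤D r s r<p s<p r≢s f[r]≡0 f[s]≡0 with reduce (- (+ r + + s))
  ... | t , t<p , q≡t = N≡length p polynomial {r ∷ s ∷ t ∷ []}
      ((r≢s ∷ r≢t ∷ []) ∷ (s≢t ∷ []) ∷ [] ∷ [])
      (λ {y} → mk⇔
        (λ (y<p , f[y]≡0) → listed y<p (exhaustive (+ y) (subst (+ p ∣_) (eval≡f (+ y)) f[y]≡0)))
        λ where
          (here refl)                 → r<p , isRoot r f[r]≡0
          (there (here refl))         → s<p , isRoot s f[s]≡0
          (there (there (here refl))) → t<p , isRoot t (f-cong q (+ t) q≡t third))
    where
    r≢s′ : ¬ (+ p ∣ + r - + s)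
    r≢s′ r≡s = r≢s (residue-unique r<p s<p r≡s)
    open Roots prime
    open Pair (+ r) (+ s) f[r]≡0 f[s]≡0 r≢s′

    q : ℤ
    q = - (+ r + + s)

    isRoot : ∀ y → + p ∣ f (+ y) → + p ∣ eval polynomial (+ y)
    isRoot y = subst (+ p ∣_) (sym (eval≡f (+ y)))

    r≢t : ¬ (r ≡ t)
    r≢t refl = third-distinct p∤D (∣-swap q (+ r) q≡t)

    s≢t : ¬ (s ≡ t)
    s≢t refl = Pair.third-distinct (+ s) (+ r) f[s]≡0 f[r]≡0 (r≢s′ ∘ ∣-swap (+ s) (+ r)) p∤D
      (subst (λ z → + p ∣ + s - z) (cong -_ (ℤ.+-comm (+ r) (+ s))) (∣-swap q (+ s) q≡t))

    listed : ∀ {y} → y ℕ.< p → + p ∣ + y - + r ⊎ + p ∣ + y - + s ⊎ + p ∣ + y - q → y ∈ r ∷ s ∷ t ∷ []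
    listed y<p (inj₁ y≡r)        = here (residue-unique y<p r<p y≡r)
    listed y<p (inj₂ (inj₁ y≡s)) = there (here (residue-unique y<p s<p y≡s))
    listed {y} y<p (inj₂ (inj₂ y≡q)) = there (there (here (residue-unique y<p t<p
      (combine₂ y≡q q≡t 1ℤ 1ℤ (identity (+ y) q (+ t))))))
      where
      identity : ∀ y q t → y - t ≡ 1ℤ * (y - q) + 1ℤ * (q - t)
      identity = solve-∀

  module Recurrence
    (p∤2 : ¬ (+ p ∣ + 2)) (p∤3 : ¬ (+ p ∣ + 3)) (p∤D : ¬ (+ p ∣ D)) (p∤a : ¬ (+ p ∣ a)) (p∤b : ¬ (+ p ∣ b))
    {U B t} (at≡U : + p ∣ a * t - U) (X^p≈β : X RExp.^ p R.≈ (- + 2 * a * t , B , - + 3 * t)) where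

    open Reduced X^p≈β
    open Permutation prime (Q≡a p∤2) (H≡b p∤2)

    DU²≡0⇒t≡0 : + p ∣ D * U ^ 2 - 0ℤ → + p ∣ t
    DU²≡0⇒t≡0 DU²≡0 = cancelˡ p∤a (combine₂ at≡U U≡0 1ℤ 1ℤ (identity₂ (a * t) U))
      where
      identity₁ : ∀ D U → D * (U * (U * 1ℤ)) - 0ℤ ≡ D * (U * U)
      identity₁ = solve-∀
      identity₂ : ∀ s U → s ≡ 1ℤ * (s - U) + 1ℤ * U
      identity₂ = solve-∀
      U≡0 : + p ∣ U
      U≡0 = square (cancelˡ p∤D (subst (+ p ∣_) (identity₁ D U) DU²≡0))

    t≡0⇒DU²≡0 : + p ∣ t → + p ∣ D * U ^ 2 - 0ℤ
    t≡0⇒DU²≡0 t≡0 = combine₂ at≡U t≡0 (- (D * U)) (D * U * a) (identity a D t U)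
      where
      identity : ∀ a D t U → D * (U * (U * 1ℤ)) - 0ℤ ≡ - (D * U) * (a * t - U) + D * U * a * t
      identity = solve-∀

    -- As U ≡ a t, the quantities D U² - a⁴ and a² (D t² - a²) agree; with a invertible, this
    -- transfers the condition in both directions.
    a²[Dt²-a²]≡DU²-a⁴ : + p ∣ a * (a * (D * (t * t) - a * a)) - (D * U ^ 2 - a ^ 4)
    a²[Dt²-a²]≡DU²-a⁴ = subst (+ p ∣_) (sym (identity a D t U)) (∣n⇒∣m*n (D * (a * t + U)) at≡U)
      where
      identity : ∀ a D t U → a * (a * (D * (t * t) - a * a)) - (D * (U * (U * 1ℤ)) - a * (a * (a * (a * 1ℤ)))) ≡
                 D * (a * t + U) * (a * t - U)
      identity = solve-∀

    DU²≡a⁴⇒Dt²≡a² : + p ∣ D * U ^ 2 - a ^ 4 → + p ∣ D * (t * t) - a * a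
    DU²≡a⁴⇒Dt²≡a² DU²≡a⁴ = cancelˡ p∤a (cancelˡ p∤a
      (combine₂ a²[Dt²-a²]≡DU²-a⁴ DU²≡a⁴ 1ℤ 1ℤ (identity (a * (a * (D * (t * t) - a * a))) (D * U ^ 2 - a ^ 4))))
      where
      identity : ∀ x y → x ≡ 1ℤ * (x - y) + 1ℤ * y
      identity = solve-∀

    Dt²≡a²⇒DU²≡a⁴ : + p ∣ D * (t * t) - a * a → + p ∣ D * U ^ 2 - a ^ 4
    Dt²≡a²⇒DU²≡a⁴ Dt²≡a² =
      combine₂ a²[Dt²-a²]≡DU²-a⁴ Dt²≡a² (- 1ℤ) (a * a) (identity a (D * (t * t) - a * a) (D * U ^ 2 - a ^ 4))
      where
      identity : ∀ a x y → y ≡ - 1ℤ * (a * (a * x) - y) + a * a * x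
      identity = solve-∀

    Dt²≡a²⇒t≢0 : + p ∣ D * (t * t) - a * a → ¬ (+ p ∣ t)
    Dt²≡a²⇒t≢0 Dt²≡a² t≡0 = p∤a (square (combine₂ Dt²≡a² t≡0 (- 1ℤ) (D * t) (identity a D t)))
      where
      identity : ∀ a D t → a * a ≡ - 1ℤ * (D * (t * t) - a * a) + D * t * t
      identity = solve-∀

    DU²≡0⇒N≡3 : + p ∣ D * U ^ 2 - 0ℤ → N p polynomial ≡ 3
    DU²≡0⇒N≡3 DU²≡0 =
      let t≡0 = DU²≡0⇒t≡0 DU²≡0
          r , s , r<p , s<p , r≢s , f[r]≡0 , f[s]≡0 = X^p≈X⇒twoRoots (X^p≈X t≡0 (identity-if p∤a p∤b t≡0))
      in twoRoots⇒N≡3 p∤D r s r<p s<p r≢s f[r]≡0 f[s]≡0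

    DU²≡a⁴⇒N≡0 : + p ∣ D * U ^ 2 - a ^ 4 → N p polynomial ≡ 0
    DU²≡a⁴⇒N≡0 DU²≡a⁴ = noRoot⇒N≡0 λ r f[r]≡0 →
      fixedRoot⇒Dt²≢a² p∤b p∤D (Dt²≡a²⇒t≢0 Dt²≡a²) r f[r]≡0 (fixesRoots r f[r]≡0) Dt²≡a²
      where Dt²≡a² = DU²≡a⁴⇒Dt²≡a² DU²≡a⁴

    otherwise⇒N≡1 : ¬ (+ p ∣ D * U ^ 2 - 0ℤ) → ¬ (+ p ∣ D * U ^ 2 - a ^ 4) → N p polynomial ≡ 1
    otherwise⇒N≡1 DU²≢0 DU²≢a⁴ =
      let p∤t = DU²≢0 ∘ t≡0⇒DU²≡0
          r , f[r]≡0 = root-if p∤a p∤D p∤t (DU²≢a⁴ ∘ Dt²≡a²⇒DU²≡a⁴)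
      in uniqueRoot⇒N≡1 r f[r]≡0 λ s f[s]≡0 → atMostOneFixedRoot p∤3 p∤D p∤t fixesRoots r s f[r]≡0 f[s]≡0

module _ {p : ℕ} (prime : Prime p) (a b : ℤ) where

  open DepressedCubic a b
  open FrobeniusImage prime a b
  open RootCount prime a b

  -- Δ, w and k stand for disc f, the last factor and N p f; keeping them opaque avoids unfolding them.
  classification : (u : ℕ → ℤ) → u 0 ≡ 0ℤ → u 1 ≡ - a → u 2 ≡ - b →
    (∀ n → u (n ℕ.+ 3) + a * u (n ℕ.+ 1) + b * u n ≡ 0ℤ) →
    ∀ Δ w k → Δ ≡ D → k ≡ N p polynomial → ¬ (+ p ∣ + 6 * Δ * a * b * w) →
    (Δ * u (p ∸ 1) ^ 2 ≡ 0ℤ [mod p ] → k ≡ 3) ×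
    (Δ * u (p ∸ 1) ^ 2 ≡ a ^ 4 [mod p ] → k ≡ 0) ×
    (¬ (Δ * u (p ∸ 1) ^ 2 ≡ 0ℤ [mod p ]) →
     ¬ (Δ * u (p ∸ 1) ^ 2 ≡ a ^ 4 [mod p ]) → k ≡ 1)
  classification u u₀ u₁ u₂ recurrence Δ w k refl refl p∤ = DU²≡0⇒N≡3 , DU²≡a⁴⇒N≡0 , otherwise⇒N≡1
    where
    p∤6 : ¬ (+ p ∣ + 6)
    p∤6 p∣6 = p∤ (∣m⇒∣m*n w (∣m⇒∣m*n b (∣m⇒∣m*n a (∣m⇒∣m*n Δ p∣6))))
    p∤2 : ¬ (+ p ∣ + 2)
    p∤2 p∣2 = p∤6 (∣m⇒∣m*n (+ 3) p∣2)
    p∤3 : ¬ (+ p ∣ + 3)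
    p∤3 p∣3 = p∤6 (∣n⇒∣m*n (+ 2) p∣3)
    p∤D : ¬ (+ p ∣ D)
    p∤D p∣D = p∤ (∣m⇒∣m*n w (∣m⇒∣m*n b (∣m⇒∣m*n a (∣n⇒∣m*n (+ 6) p∣D))))
    p∤a : ¬ (+ p ∣ a)
    p∤a p∣a = p∤ (∣m⇒∣m*n w (∣m⇒∣m*n b (∣n⇒∣m*n (+ 6 * Δ) p∣a)))
    p∤b : ¬ (+ p ∣ b)
    p∤b p∣b = p∤ (∣m⇒∣m*n w (∣n⇒∣m*n (+ 6 * Δ * a) p∣b))

    image = reducedImage p∤2 p∤a
    B t : ℤ
    B = proj₁ image
    t = proj₁ (proj₂ image)

    u[p-1]≡ : u (p ∸ 1) ≡ linearPart (X RExp.^ p)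
    u[p-1]≡ = trans (u≡linearPart u u₀ u₁ u₂ recurrence (p ∸ 1))
      (cong (λ n → linearPart (X RExp.^ n)) (ℕ.suc-pred p {{prime⇒nonZero prime}}))

    at≡u[p-1] : + p ∣ a * t - u (p ∸ 1)
    at≡u[p-1] = subst (λ U → + p ∣ a * t - U) (sym u[p-1]≡) (proj₂ (proj₂ (proj₂ image)))

    open Recurrence p∤2 p∤3 p∤D p∤a p∤b {u (p ∸ 1)} {B} {t} at≡u[p-1] (proj₁ (proj₂ (proj₂ image)))

theorem6 :
    (a₂ a₃ : ℤ) (u : ℕ → ℤ) →
    u 0 ≡ 0ℤ → u 1 ≡ - a₂ → u 2 ≡ - a₃ →
    (∀ n → u (n ℕ.+ 3) + a₂ * u (n ℕ.+ 1) + a₃ * u n ≡ 0ℤ) →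
    let f = 1ℤ ∷ 0ℤ ∷ a₂ ∷ a₃ ∷ []
        d = + 9 * a₃ ^ 2 - + 4 * a₂ ^ 3
        D = disc f
    in
    (p : ℕ) → Prime p →
    ¬ (+ p ∣ + 6 * D * a₂ * a₃ *
         ((+ 20 * a₂ ^ 3 * a₃ + + 27 * a₂ ^ 3 + + 9 * a₂ * d) ^ 2
           - d * (+ 31 * a₂ ^ 2 + d) ^ 2)) →
    (D * u (p ∸ 1) ^ 2 ≡ 0ℤ [mod p ] → N p f ≡ 3) ×
    (D * u (p ∸ 1) ^ 2 ≡ a₂ ^ 4 [mod p ] → N p f ≡ 0) ×
    (¬ (D * u (p ∸ 1) ^ 2 ≡ 0ℤ [mod p ]) →
     ¬ (D * u (p ∸ 1) ^ 2 ≡ a₂ ^ 4 [mod p ]) → N p f ≡ 1)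
theorem6 a b u u₀ u₁ u₂ recurrence p p-prime =
  let f = 1ℤ ∷ 0ℤ ∷ a ∷ b ∷ []
      d = + 9 * b ^ 2 - + 4 * a ^ 3
  in classification p-prime a b u u₀ u₁ u₂ recurrence (disc f)
       ((+ 20 * a ^ 3 * b + + 27 * a ^ 3 + + 9 * a * d) ^ 2 - d * (+ 31 * a ^ 2 + d) ^ 2) (N p f)
       (disc-cubic a b) refl
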